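{- For any fixed dimension $d\ge 1$, the functions $n\mapsto M_d(n,n)$, $n\mapsto E_d(n)$ and $n\mapsto W_d(n)$ are pairwise asymptotically equivalent, where two functions $f,g:\mathbf{N}\to\mathbf{N}$ are called asymptotically equivalent if there exist constants $c_1,c_2>0$ such that $c_1f(n)\leq g(n)\leq c_2f(n)$ for all $n\geq 2$.
   Context: A set of points in $\mathbf{R}^d$ is convexly independent if it is the vertex set of its convex hull, i.e. no point of it lies in the convex hull of the others. $E_d(n)$: for a finite set $P\subset\mathbf{R}^d$, let $E(P)$ be the maximum number of (unordered) pairs of distinct points of $P$ such that the midpoints of these pairs are convexly independent (distinct pairs selected having distinct midpoints); $E_d(n)=\max\{E(P): P\subset\mathbf{R}^d, |P|=n\}$. $M_d(m,n)$: the maximum size of a convexly independent subset of the Minkowski sum $P+Q=\{p+q: p\in P,q\in Q\}$, the maximum being over all sets $P$ of $m$ points and $Q$ of $n$ points in $\mathbf{R}^d$. $W_d(n)$: the maximum number of pairwise nonparallel segments of unit length (measured in the norm) with both endpoints in a set of $n$ points, the maximum being over all sets of $n$ points in $\mathbf{R}^d$ and all strictly convex norms on $\mathbf{R}^d$ (a norm is strictly convex if its unit sphere contains no nondegenerate line segment). -}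

module Defs where

open import Algebra.Bundles using (CommutativeRing)
open import Axiom.ExcludedMiddle using (ExcludedMiddle)
open import Data.Fin as Fin using (Fin)
import Data.Fin.Properties as Fin
open import Data.Nat as ℕ using (ℕ; zero; suc)
import Data.Nat.Properties as ℕ
open import Data.Product using (Σ; ∃; ∃₂; _×_; _,_; proj₁; proj₂)
open import Data.Sum using ([_,_]′)
open import Data.Vec.Functional using (Vector)
open import Function using (_↣_; Injection; mk↣; _∘_; const)
open import Level using (0ℓ)
open import Relation.Binary using (Rel; IsTotalOrder)
open import Relation.Binary.PropositionalEquality as ≡ using (_≡_; _≢_)
open import Relation.Nullary using (¬_; yes; no)
open import Relation.Unary using (Pred; _⊆_)

-- The real numbers, axiomatised as a Dedekind-complete ordered field (unique
-- up to isomorphism in the presence of excluded middle).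

record CompleteOrderedField : Set₁ where
  infix 8 _⁻¹
  infix 4 _≤_

  field
    commutativeRing : CommutativeRing 0ℓ 0ℓ

  open CommutativeRing commutativeRing public renaming (Carrier to ℝ)

  field
    _≤_          : Rel ℝ 0ℓ
    isTotalOrder : IsTotalOrder _≈_ _≤_
    0≉1          : 0# ≉ 1#
    -- The value of 0# ⁻¹ is unspecified.
    _⁻¹          : ℝ → ℝ
    ⁻¹-inverseʳ  : ∀ {x} → x ≉ 0# → x * x ⁻¹ ≈ 1#
    +-monoʳ-≤    : ∀ x {y z} → y ≤ z → x + y ≤ x + z
    *-nonNeg     : ∀ {x y} → 0# ≤ x → 0# ≤ y → 0# ≤ x * y

  UpperBound : Pred ℝ 0ℓ → Pred ℝ 0ℓ
  UpperBound S b = ∀ {x} → S x → x ≤ b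

  field
    complete : (S : Pred ℝ 0ℓ) → ∃ S → ∃ (UpperBound S) →
               ∃ λ s → UpperBound S s × (∀ {b} → UpperBound S b → s ≤ b)

  open import Relation.Binary.Construct.NonStrictToStrict _≈_ _≤_ public
    using (_<_)

  open import Algebra.Definitions.RawMonoid +-rawMonoid public
    using (sum) renaming (_×_ to _×ℕ_)

  fromℕ : ℕ → ℝ
  fromℕ n = n ×ℕ 1#

  ½ : ℝ
  ½ = (1# + 1#) ⁻¹

  ∣_∣ : ℝ → ℝ
  ∣ x ∣ = [ const x , const (- x) ]′ (IsTotalOrder.total isTotalOrder 0# x)

-- Excluded middle makes the maximum of a bounded set of naturals computable.
-- The maximum of the empty set is 0 by convention.

module Maximum (lem : ExcludedMiddle 0ℓ) where

  greatestUpTo : Pred ℕ 0ℓ → ℕ → ℕ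
  greatestUpTo S zero    = zero
  greatestUpTo S (suc b) with lem {S (suc b)}
  ... | yes _ = suc b
  ... | no  _ = greatestUpTo S b

  Bounded : Pred ℕ 0ℓ → Set
  Bounded S = ∃ λ b → ∀ {k} → S k → k ℕ.≤ b

  max : (S : Pred ℕ 0ℓ) → Bounded S → ℕ
  max S (b , _) = greatestUpTo S b

  private
    upper : ∀ (S : Pred ℕ 0ℓ) b {k} → S k → k ℕ.≤ b → k ℕ.≤ greatestUpTo S b
    upper S zero    _  k≤b = k≤b
    upper S (suc b) Sk k≤b with lem {S (suc b)}
    ... | yes _  = k≤b
    ... | no ¬Sb = upper S b Sk (ℕ.s≤s⁻¹ (ℕ.≤∧≢⇒< k≤b λ { ≡.refl → ¬Sb Sk }))

    attained : ∀ (S : Pred ℕ 0ℓ) b {k} → S k → k ℕ.≤ b → S (greatestUpTo S b)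
    attained S zero    Sk ℕ.z≤n = Sk
    attained S (suc b) Sk k≤b with lem {S (suc b)}
    ... | yes Sb = Sb
    ... | no ¬Sb = attained S b Sk (ℕ.s≤s⁻¹ (ℕ.≤∧≢⇒< k≤b λ { ≡.refl → ¬Sb Sk }))

  max-upper : ∀ {S} (bdd : Bounded S) {k} → S k → k ℕ.≤ max S bdd
  max-upper {S} (b , ub) Sk = upper S b Sk (ub Sk)

  max-attained : ∀ {S} (bdd : Bounded S) {k} → S k → S (max S bdd)
  max-attained {S} (b , ub) Sk = attained S b Sk (ub Sk)

module Geometry (R : CompleteOrderedField) where

  open CompleteOrderedField R

  open import Data.Vec.Functional.Relation.Binary.Equality.Setoid setoid public
    using (_≋_; ≋-setoid; ≋-sym; ≋-trans)

  infixl 6 _+ᵥ_ _-ᵥ_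
  infixr 7 _·_
  infixl 6 _⊕_

  Point : ℕ → Set
  Point d = Vector ℝ d

  _+ᵥ_ _-ᵥ_ : ∀ {d} → Point d → Point d → Point d
  (p +ᵥ q) j = p j + q j
  (p -ᵥ q) j = p j - q j

  _·_ : ∀ {d} → ℝ → Point d → Point d
  (a · p) j = a * p j

  0ᵥ : ∀ {d} → Point d
  0ᵥ j = 0#

  midpoint : ∀ {d} → Point d → Point d → Point d
  midpoint p q = ½ · (p +ᵥ q)

  linearCombination : ∀ {d k} → Vector ℝ k → Vector (Point d) k → Point d
  linearCombination w p j = sum (λ i → w i * p i j)

  convexHull : ∀ {d} → Pred (Point d) 0ℓ → Pred (Point d) 0ℓ
  convexHull {d} S x =
    ∃ λ k → Σ (Vector ℝ k) λ w → Σ (Vector (Point d) k) λ p →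
      (∀ i → 0# ≤ w i) × sum w ≈ 1# × (∀ i → S (p i)) × x ≋ linearCombination w p

  ConvexlyIndependent : ∀ {d} → Pred (Point d) 0ℓ → Set
  ConvexlyIndependent S = ∀ {x} → S x → ¬ convexHull (λ y → S y × ¬ (y ≋ x)) x

  -- A set of exactly n points of ℝᵈ, given by an enumeration without repetition.
  PointSet : ℕ → ℕ → Set
  PointSet d n = Injection (≡.setoid (Fin n)) (≋-setoid d)

  ⟦_⟧ : ∀ {d n} → PointSet d n → Pred (Point d) 0ℓ
  ⟦ P ⟧ x = ∃ λ i → x ≋ Injection.to P i

  _⊕_ : ∀ {d} → Pred (Point d) 0ℓ → Pred (Point d) 0ℓ → Pred (Point d) 0ℓ
  (S ⊕ T) x = ∃₂ λ p q → S p × T q × x ≋ p +ᵥ q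

  -- Unordered pairs of distinct indices, each listed in increasing order.
  Pair : ℕ → Set
  Pair n = Σ (Fin n × Fin n) λ (i , j) → i Fin.< j

  onPair : ∀ {d n} {A : Set} → (Point d → Point d → A) → PointSet d n → Pair n → A
  onPair f P ((i , j) , _) = f (Injection.to P i) (Injection.to P j)

  record Norm (d : ℕ) : Set where
    field
      ‖_‖         : Point d → ℝ
      cong        : ∀ {x y} → x ≋ y → ‖ x ‖ ≈ ‖ y ‖
      nonNeg      : ∀ x → 0# ≤ ‖ x ‖
      definite    : ∀ {x} → ‖ x ‖ ≈ 0# → x ≋ 0ᵥ
      homogeneous : ∀ a x → ‖ a · x ‖ ≈ ∣ a ∣ * ‖ x ‖
      triangle    : ∀ x y → ‖ x +ᵥ y ‖ ≤ ‖ x ‖ + ‖ y ‖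

  StrictlyConvex : ∀ {d} → Norm d → Set
  StrictlyConvex N =
    ∀ {x y} → ¬ (x ≋ y) →
      ¬ (∀ t → 0# ≤ t → t ≤ 1# → ‖ (1# - t) · x +ᵥ t · y ‖ ≈ 1#)
    where open Norm N

  -- For nonzero vectors, hence for directions of unit segments, this relation
  -- is symmetric.
  Parallel : ∀ {d} → Rel (Point d) 0ℓ
  Parallel u v = ∃ λ c → u ≋ c · v

  -- The following predicates say that k is the size of some admissible
  -- configuration.

  ConvexSubsetOfSum : (d m n : ℕ) → Pred ℕ 0ℓ
  ConvexSubsetOfSum d m n k =
    Σ (PointSet d m) λ P → Σ (PointSet d n) λ Q → Σ (PointSet d k) λ S →
      ⟦ S ⟧ ⊆ ⟦ P ⟧ ⊕ ⟦ Q ⟧ × ConvexlyIndependent ⟦ S ⟧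

  ConvexMidpoints : ∀ {d n} → PointSet d n → Pred ℕ 0ℓ
  ConvexMidpoints {n = n} P k =
    Σ (Fin k ↣ Pair n) λ e →
      let mid = onPair midpoint P ∘ Injection.to e in
      (∀ {a b} → mid a ≋ mid b → a ≡ b) ×
      ConvexlyIndependent (λ x → ∃ λ a → x ≋ mid a)

  NonparallelUnitSegments : (d n : ℕ) → Pred ℕ 0ℓ
  NonparallelUnitSegments d n k =
    Σ (PointSet d n) λ P → Σ (Norm d) λ N → StrictlyConvex N ×
    Σ (Fin k ↣ Pair n) λ e →
      let dir = onPair _-ᵥ_ P ∘ Injection.to e in
      (∀ a → Norm.‖_‖ N (dir a) ≈ 1#) ×
      (∀ {a b} → a ≢ b → ¬ Parallel (dir a) (dir b))

  private
    ↣×⇒≤ : ∀ {k m n} (f : Fin k → Fin m × Fin n) →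
            (∀ {a b} → f a ≡ f b → a ≡ b) → k ℕ.≤ m ℕ.* n
    ↣×⇒≤ f inj = Fin.injective⇒≤ {f = λ a → Fin.combine (proj₁ (f a)) (proj₂ (f a))} λ eq →
      let eq₁ , eq₂ = Fin.combine-injective _ _ _ _ eq in inj (≡.cong₂ _,_ eq₁ eq₂)

  pairs-bound : ∀ {k n} → Fin k ↣ Pair n → k ℕ.≤ n ℕ.* n
  pairs-bound e = ↣×⇒≤ (proj₁ ∘ to) λ eq → injective (Pair-≡ eq)
    where
    open Injection e
    Pair-≡ : ∀ {n} {p q : Pair n} → proj₁ p ≡ proj₁ q → p ≡ q
    Pair-≡ {p = _ , i<j} {_ , i<j′} ≡.refl = ≡.cong (_ ,_) (ℕ.<-irrelevant i<j i<j′)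

  convexSubsetOfSum-bound : ∀ {d m n k} → ConvexSubsetOfSum d m n k → k ℕ.≤ m ℕ.* n
  convexSubsetOfSum-bound {m = m} {n} {k} (P , Q , S , S⊆P⊕Q , _) =
    ↣×⇒≤ (proj₁ ∘ summands) λ {a} {b} eq → injective (≋-trans (proj₂ (summands a))
      (≡.subst (λ ij → sumAt ij ≋ to b) (≡.sym eq) (≋-sym (proj₂ (summands b)))))
    where
    open Injection S

    sumAt : Fin m × Fin n → Point _
    sumAt (i , j) = Injection.to P i +ᵥ Injection.to Q j

    summands : ∀ a → ∃ λ ij → to a ≋ sumAt ij
    summands a with _ , _ , (i , p≋) , (j , q≋) , s≋ ← S⊆P⊕Q (a , λ _ → refl) =
      (i , j) , ≋-trans s≋ λ l → +-cong (p≋ l) (q≋ l)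

module Extremal (lem : ExcludedMiddle 0ℓ) (R : CompleteOrderedField) where

  open CompleteOrderedField R
  open Geometry R
  open Maximum lem

  M : (d m n : ℕ) → ℕ
  M d m n = max (ConvexSubsetOfSum d m n) (m ℕ.* n , convexSubsetOfSum-bound)

  midpoints-bounded : ∀ {d n} (P : PointSet d n) → Bounded (ConvexMidpoints P)
  midpoints-bounded {n = n} P = n ℕ.* n , λ (e , _) → pairs-bound e

  E-of : ∀ {d n} → PointSet d n → ℕ
  E-of P = max (ConvexMidpoints P) (midpoints-bounded P)

  E-of-bound : ∀ {d n} (P : PointSet d n) → E-of P ℕ.≤ n ℕ.* n
  E-of-bound P = pairs-bound (proj₁ (max-attained (midpoints-bounded P) none))
    where
    none : ConvexMidpoints P 0
    none = mk↣ {to = λ ()} (λ { {()} }) , (λ { {()} }) , λ ()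

  E : (d n : ℕ) → ℕ
  E d n = max (λ k → ∃ λ (P : PointSet d n) → E-of P ≡ k)
              (n ℕ.* n , λ { (P , ≡.refl) → E-of-bound P })

  W : (d n : ℕ) → ℕ
  W d n = max (NonparallelUnitSegments d n)
              (n ℕ.* n , λ (_ , _ , _ , e , _) → pairs-bound e)

  AsymptoticallyEquivalent : Rel (ℕ → ℕ) 0ℓ
  AsymptoticallyEquivalent f g =
    ∃₂ λ c₁ c₂ → 0# < c₁ × 0# < c₂ ×
      (∀ n → 2 ℕ.≤ n → c₁ * fromℕ (f n) ≤ fromℕ (g n) × fromℕ (g n) ≤ c₂ * fromℕ (f n))

{-# OPTIONS --safe #-}

module Submission where

open import Defs
open import Algebra.Bundles using (CommutativeRing; RawRing)
open import Algebra.Solver.Ring.AlmostCommutativeRing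
  using (fromCommutativeRing; _-Raw-AlmostCommutative⟶_; Induced-equivalence)
open import Axiom.ExcludedMiddle using (ExcludedMiddle)
open import Data.Empty using (⊥-elim)
open import Data.Fin as Fin using (Fin; zero; suc)
import Data.Fin.Properties as Fin
open import Data.List as List using (List; []; _∷_; map; filter; cartesianProductWith)
open import Data.List.Membership.Propositional using (_∈_)
open import Data.List.Membership.Propositional.Properties
  using (∈-++⁺ˡ; ∈-++⁺ʳ; ∈-++⁻; ∈-map⁺; ∈-map⁻; ∈-filter⁺; ∈-filter⁻; ∈-tabulate⁺; ∈-tabulate⁻;
         ∈-cartesianProductWith⁺; ∈-cartesianProductWith⁻)
open import Data.List.Relation.Unary.Any using (here; there)
open import Data.Maybe using (just; nothing)
open import Data.Nat as ℕ using (ℕ)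
import Data.Nat.Properties as ℕ
open import Data.Product using (Σ; ∃; ∃₂; _×_; _,_; proj₁; proj₂)
open import Data.Sum using (_⊎_; inj₁; inj₂)
import Data.Vec.Functional as Vector
open import Function using (_∘_; id; mk↣; Injection)
open import Level using (0ℓ)
open import Relation.Binary using (IsTotalOrder; Poset)
open import Relation.Binary.Definitions using (WeaklyDecidable; tri<; tri≈; tri>)
open import Relation.Binary.PropositionalEquality as ≡ using (_≡_; _≢_)
open import Relation.Nullary using (¬_; Dec; yes; no)
open import Relation.Unary using (Pred; Decidable; ∁)

-- Midpoints are sums of two points of ½P, and unit segments are differences, that
-- is, sums of points of P and -P; pairwise nonparallel ones are distinct points of
-- a strictly convex sphere, hence convexly independent. So E and W are at most M.
--
-- Conversely, pass from a convexly independent subset of P + Q to the sums coming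
-- from one of the nine pairs of blocks of about n/2 points, so that n points
-- suffice for both summands. The sum p + q is the midpoint of 2p + v and 2q - v.
-- For W, each sum s is separated from the others by a linear functional f, and a
-- fraction 1/(2d) of these functionals are positive on a common vector ±eⱼ. After a
-- translation of P far along it, |f| is larger at s than at the other sums, so some
-- ellipsoid has s on its boundary and contains the other sums. The intersection of
-- these ellipsoids is the unit ball of a strictly convex norm in which all the sums
-- p - (-q) are pairwise nonparallel unit vectors.

-- `E` and `W` take both ends of a pair from one set of n points, so that set has to hold a copy of
-- each summand; this is why the blocks have ⌊n/2⌋ and ⌈n/2⌉ points. Three blocks per summand are
-- taken because two blocks of ⌊n/2⌋ points miss a point for odd n, while 3⌊n/2⌋ ≥ n for all n ≥ 2.
-- The obstacle for `W` is the symmetry of a norm: a unit ball containing s′ contains -s′, so a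
-- functional f with f(s′) < f(s) does not suffice, and |f(s′)| < |f(s)| is required. Translating
-- all sums along u leaves f(s) - f(s′) unchanged and raises f(s) + f(s′) when f(u) > 0. The
-- translation must be the same for all sums, but their functionals need not be positive on a common
-- vector; the passage to one of 2d classes secures this and costs the factor 2d. The slab |f| ≤
-- f(s) is neither bounded nor strictly convex in general. Adding the Euclidean square to a large
-- multiple of f² repairs both, and a maximum of finitely many such forms stays strictly convex.

-- Ring solver with integer coefficients over a commutative ring.

module RingSolver {c ℓ} (R : CommutativeRing c ℓ) where

  open CommutativeRing R
  open import Algebra.Properties.AbelianGroup +-abelianGroup
    using (⁻¹-∙-comm; ⁻¹-anti-homo‿-)
  open import Algebra.Properties.CommutativeSemigroup +-commutativeSemigroup
    using (interchange)
  open import Algebra.Properties.Group +-group using (ε⁻¹≈ε)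
  open import Algebra.Properties.Monoid.Mult.TCOptimised +-monoid using (×-homo-+)
    renaming (_×_ to _×ℕ_)
  open import Algebra.Properties.Ring ring using (x[y-z]≈xy-xz; [y-z]x≈yx-zx)
  open import Algebra.Properties.Semiring.Mult.TCOptimised semiring using (×1-homo-*)
  open import Relation.Binary.Reasoning.Setoid setoid

  -- The pair (m , n) stands for the integer m - n. Reducing the results of
  -- the operations makes the solver's normal forms unique.
  reduce : ℕ × ℕ → ℕ × ℕ
  reduce (m , n) = m ℕ.∸ n , n ℕ.∸ m

  differences : RawRing _ _
  differences = record
    { Carrier = ℕ × ℕ
    ; _≈_     = _≡_
    ; _+_     = λ (a , b) (c , d) → reduce (a ℕ.+ c , b ℕ.+ d)
    ; _*_     = λ (a , b) (c , d) → reduce (a ℕ.* c ℕ.+ b ℕ.* d , a ℕ.* d ℕ.+ b ℕ.* c)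
    ; -_      = λ (a , b) → b , a
    ; 0#      = 0 , 0
    ; 1#      = 1 , 0
    }

  private
    ι : ℕ → Carrier
    ι n = n ×ℕ 1#

    ι-+ : ∀ m n → ι (m ℕ.+ n) ≈ ι m + ι n
    ι-+ = ×-homo-+ 1#

    x-0≈x : ∀ x → x - 0# ≈ x
    x-0≈x x = trans (+-congˡ ε⁻¹≈ε) (+-identityʳ x)

    +-difference : ∀ a b c d → (a + c) - (b + d) ≈ (a - b) + (c - d)
    +-difference a b c d = trans (+-congˡ (sym (⁻¹-∙-comm b d))) (interchange a c (- b) (- d))

    *-difference : ∀ a b c d →
      (a * c + b * d) - (a * d + b * c) ≈ (a - b) * (c - d)
    *-difference a b c d = begin
      (a * c + b * d) - (a * d + b * c)   ≈⟨ +-difference _ _ _ _ ⟩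
      (a * c - a * d) + (b * d - b * c)   ≈⟨ +-congˡ (⁻¹-anti-homo‿- _ _) ⟨
      (a * c - a * d) - (b * c - b * d)
        ≈⟨ +-cong (x[y-z]≈xy-xz a c d) (-‿cong (x[y-z]≈xy-xz b c d)) ⟨
      a * (c - d) - b * (c - d)           ≈⟨ [y-z]x≈yx-zx (c - d) a b ⟨
      (a - b) * (c - d)                   ∎

    ι-+* : ∀ a b c d → ι (a ℕ.* b ℕ.+ c ℕ.* d) ≈ ι a * ι b + ι c * ι d
    ι-+* a b c d = trans (ι-+ (a ℕ.* b) (c ℕ.* d)) (+-cong (×1-homo-* a b) (×1-homo-* c d))

    -- Making x - 0 reduce to x lets the constants 0# and 1# of a goal be
    -- recognised definitionally.
    ⟦_⟧ : ℕ × ℕ → Carrier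
    ⟦ m , ℕ.zero  ⟧ = ι m
    ⟦ m , ℕ.suc n ⟧ = ι m - ι (ℕ.suc n)

    ⟦⟧≈ : ∀ m n → ⟦ m , n ⟧ ≈ ι m - ι n
    ⟦⟧≈ m ℕ.zero    = sym (x-0≈x _)
    ⟦⟧≈ m (ℕ.suc n) = refl

    cross : ∀ {a b c d} → a + d ≈ c + b → a - b ≈ c - d
    cross {a} {b} {c} {d} eq = begin
      a - b              ≈⟨ x-0≈x _ ⟨
      (a - b) - 0#       ≈⟨ +-congˡ (-‿cong (-‿inverseʳ d)) ⟨
      (a - b) - (d - d)  ≈⟨ +-congˡ (⁻¹-anti-homo‿- d d) ⟩
      (a - b) + (d - d)  ≈⟨ +-difference a b d d ⟨
      (a + d) - (b + d)  ≈⟨ +-cong eq (-‿cong (+-comm b d)) ⟩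
      (c + b) - (d + b)  ≈⟨ +-difference c d b b ⟩
      (c - d) + (b - b)  ≈⟨ +-congˡ (-‿inverseʳ b) ⟩
      (c - d) + 0#       ≈⟨ +-identityʳ _ ⟩
      c - d              ∎

    -- Both sides are the maximum of `m` and `n`.
    ∸-+-swap : ∀ m n → m ℕ.∸ n ℕ.+ n ≡ m ℕ.+ (n ℕ.∸ m)
    ∸-+-swap ℕ.zero    ℕ.zero    = ≡.refl
    ∸-+-swap ℕ.zero    (ℕ.suc n) = ≡.refl
    ∸-+-swap (ℕ.suc m) ℕ.zero    = ≡.refl
    ∸-+-swap (ℕ.suc m) (ℕ.suc n) = ≡.trans (ℕ.+-suc (m ℕ.∸ n) n) (≡.cong ℕ.suc (∸-+-swap m n))

    reduce≈ : ∀ m n → ⟦ reduce (m , n) ⟧ ≈ ι m - ι n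
    reduce≈ m n = begin
      ⟦ reduce (m , n) ⟧         ≈⟨ ⟦⟧≈ (m ℕ.∸ n) (n ℕ.∸ m) ⟩
      ι (m ℕ.∸ n) - ι (n ℕ.∸ m)  ≈⟨ cross (begin
        ι (m ℕ.∸ n) + ι n          ≈⟨ ι-+ (m ℕ.∸ n) n ⟨
        ι (m ℕ.∸ n ℕ.+ n)          ≡⟨ ≡.cong ι (∸-+-swap m n) ⟩
        ι (m ℕ.+ (n ℕ.∸ m))        ≈⟨ ι-+ m (n ℕ.∸ m) ⟩
        ι m + ι (n ℕ.∸ m)          ∎) ⟩
      ι m - ι n                  ∎

    morphism : differences -Raw-AlmostCommutative⟶ fromCommutativeRing R
    morphism = record
      { ⟦_⟧    = ⟦_⟧
      ; +-homo = λ (a , b) (c , d) → begin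
          ⟦ reduce (a ℕ.+ c , b ℕ.+ d) ⟧ ≈⟨ reduce≈ (a ℕ.+ c) (b ℕ.+ d) ⟩
          ι (a ℕ.+ c) - ι (b ℕ.+ d)      ≈⟨ +-cong (ι-+ a c) (-‿cong (ι-+ b d)) ⟩
          (ι a + ι c) - (ι b + ι d)      ≈⟨ +-difference _ _ _ _ ⟩
          (ι a - ι b) + (ι c - ι d)      ≈⟨ +-cong (⟦⟧≈ a b) (⟦⟧≈ c d) ⟨
          ⟦ a , b ⟧ + ⟦ c , d ⟧          ∎
      ; *-homo = λ (a , b) (c , d) → begin
          ⟦ reduce (a ℕ.* c ℕ.+ b ℕ.* d , a ℕ.* d ℕ.+ b ℕ.* c) ⟧
            ≈⟨ reduce≈ (a ℕ.* c ℕ.+ b ℕ.* d) (a ℕ.* d ℕ.+ b ℕ.* c) ⟩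
          ι (a ℕ.* c ℕ.+ b ℕ.* d) - ι (a ℕ.* d ℕ.+ b ℕ.* c)
            ≈⟨ +-cong (ι-+* a c b d) (-‿cong (ι-+* a d b c)) ⟩
          (ι a * ι c + ι b * ι d) - (ι a * ι d + ι b * ι c)
            ≈⟨ *-difference _ _ _ _ ⟩
          (ι a - ι b) * (ι c - ι d)
            ≈⟨ *-cong (⟦⟧≈ a b) (⟦⟧≈ c d) ⟨
          ⟦ a , b ⟧ * ⟦ c , d ⟧
            ∎
      ; -‿homo = λ (a , b) → begin
          ⟦ b , a ⟧      ≈⟨ ⟦⟧≈ b a ⟩
          ι b - ι a      ≈⟨ ⁻¹-anti-homo‿- (ι a) (ι b) ⟨
          - (ι a - ι b)  ≈⟨ -‿cong (⟦⟧≈ a b) ⟨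
          - ⟦ a , b ⟧    ∎
      ; 0-homo = refl
      ; 1-homo = refl
      }

    _≟_ : WeaklyDecidable (Induced-equivalence morphism)
    (a , b) ≟ (c , d) with a ℕ.+ d ℕ.≟ c ℕ.+ b
    ... | no  _  = nothing
    ... | yes eq = just (begin
      ⟦ a , b ⟧  ≈⟨ ⟦⟧≈ a b ⟩
      ι a - ι b  ≈⟨ cross (trans (sym (ι-+ a d)) (trans (reflexive (≡.cong ι eq)) (ι-+ c b))) ⟩
      ι c - ι d  ≈⟨ ⟦⟧≈ c d ⟨
      ⟦ c , d ⟧  ∎)

  open import Algebra.Solver.Ring differences (fromCommutativeRing R) morphism _≟_ public
    using (solve; _:=_; _:+_; _:*_; _:-_; :-_; con; Polynomial)

  :0 :1 : ∀ {n} → Polynomial n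
  :0 = con (0 , 0)
  :1 = con (1 , 0)

-- Order, inverses, square roots and finite maxima in a complete ordered field.

module OrderedField (lem : ExcludedMiddle 0ℓ) (R : CompleteOrderedField) where

  open CompleteOrderedField R hiding (zero)
  open RingSolver commutativeRing
  import Relation.Binary.Construct.NonStrictToStrict _≈_ _≤_ as Strict
  open IsTotalOrder isTotalOrder public using (total; isPartialOrder)
    renaming (refl to ≤-refl; trans to ≤-trans; antisym to ≤-antisym; reflexive to ≤-reflexive;
              ≤-respˡ-≈ to ≤-respˡ; ≤-respʳ-≈ to ≤-respʳ)

  ≤-poset : Poset _ _ _
  ≤-poset = record { isPartialOrder = isPartialOrder }

  module ≤-Reasoning where
    open import Relation.Binary.Reasoning.PartialOrder ≤-poset public

  open ≤-Reasoning

  abstract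

    <⇒≤ : ∀ {x y} → x < y → x ≤ y
    <⇒≤ = proj₁

    <⇒≱ : ∀ {x y} → x < y → ¬ (y ≤ x)
    <⇒≱ = Strict.<⇒≱ ≤-antisym

    ≰⇒> : ∀ {x y} → ¬ (x ≤ y) → y < x
    ≰⇒> = Strict.≰⇒> sym ≤-reflexive total

    ≮⇒≥ : ∀ {x y} → ¬ (x < y) → y ≤ x
    ≮⇒≥ = Strict.≮⇒≥ sym (λ _ _ → lem) ≤-reflexive total

    <-respʳ : ∀ {x y z} → y ≈ z → x < y → x < z
    <-respʳ y≈z (x≤y , x≉y) = ≤-respʳ y≈z x≤y , λ x≈z → x≉y (trans x≈z (sym y≈z))

    <-respˡ : ∀ {x y z} → y ≈ z → y < x → z < x
    <-respˡ y≈z (y≤x , y≉x) = ≤-respˡ y≈z y≤x , λ z≈x → y≉x (trans y≈z z≈x)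

    <-trans : ∀ {x y z} → x < y → y < z → x < z
    <-trans = Strict.<-trans isPartialOrder

    <-≤-trans : ∀ {x y z} → x < y → y ≤ z → x < z
    <-≤-trans = Strict.<-≤-trans sym ≤-trans ≤-antisym ≤-respʳ

    ≤-<-trans : ∀ {x y z} → x ≤ y → y < z → x < z
    ≤-<-trans = Strict.≤-<-trans ≤-trans ≤-antisym ≤-respˡ

    +-mono-≤ : ∀ {u v x y} → u ≤ v → x ≤ y → u + x ≤ v + y
    +-mono-≤ {u} {v} {x} {y} u≤v x≤y = begin
      u + x  ≤⟨ +-monoʳ-≤ u x≤y ⟩
      u + y  ≈⟨ +-comm u y ⟩
      y + u  ≤⟨ +-monoʳ-≤ y u≤v ⟩
      y + v  ≈⟨ +-comm y v ⟩
      v + y  ∎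

    x≤y⇒0≤y-x : ∀ {x y} → x ≤ y → 0# ≤ y - x
    x≤y⇒0≤y-x {x} {y} x≤y = begin
      0#       ≈⟨ -‿inverseˡ x ⟨
      - x + x  ≤⟨ +-monoʳ-≤ (- x) x≤y ⟩
      - x + y  ≈⟨ +-comm _ _ ⟩
      y - x    ∎

    0≤y-x⇒x≤y : ∀ {x y} → 0# ≤ y - x → x ≤ y
    0≤y-x⇒x≤y {x} {y} 0≤y-x = begin
      x            ≈⟨ +-identityʳ x ⟨
      x + 0#       ≤⟨ +-monoʳ-≤ x 0≤y-x ⟩
      x + (y - x)  ≈⟨ solve 2 (λ a b → a :+ (b :- a) := b) refl x y ⟩
      y            ∎

    x<y⇒0<y-x : ∀ {x y} → x < y → 0# < y - x
    x<y⇒0<y-x {x} {y} (x≤y , x≉y) = x≤y⇒0≤y-x x≤y , λ 0≈y-x → x≉y (begin-equality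
      x            ≈⟨ +-identityʳ x ⟨
      x + 0#       ≈⟨ +-congˡ 0≈y-x ⟩
      x + (y - x)  ≈⟨ solve 2 (λ a b → a :+ (b :- a) := b) refl x y ⟩
      y            ∎)

    0<y-x⇒x<y : ∀ {x y} → 0# < y - x → x < y
    0<y-x⇒x<y (0≤y-x , 0≉y-x) =
      0≤y-x⇒x≤y 0≤y-x , λ x≈y → 0≉y-x (sym (trans (+-congʳ (sym x≈y)) (-‿inverseʳ _)))

    x≤0⇒0≤-x : ∀ {x} → x ≤ 0# → 0# ≤ - x
    x≤0⇒0≤-x x≤0 = ≤-respʳ (+-identityˡ _) (x≤y⇒0≤y-x x≤0)

    x<0⇒0<-x : ∀ {x} → x < 0# → 0# < - x
    x<0⇒0<-x x<0 = <-respʳ (+-identityˡ _) (x<y⇒0<y-x x<0)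

    +-nonNeg : ∀ {x y} → 0# ≤ x → 0# ≤ y → 0# ≤ x + y
    +-nonNeg 0≤x 0≤y = ≤-respˡ (+-identityˡ 0#) (+-mono-≤ 0≤x 0≤y)

    +-mono-<-≤ : ∀ {u v x y} → u < v → x ≤ y → u + x < v + y
    +-mono-<-≤ {u} {v} {x} {y} u<v x≤y = ≰⇒> λ v+y≤u+x → <⇒≱ u<v (begin
      v            ≈⟨ solve 2 (λ a b → a := (a :+ b) :- b) refl v y ⟩
      (v + y) - y  ≤⟨ +-mono-≤ v+y≤u+x ≤-refl ⟩
      (u + x) - y  ≤⟨ 0≤y-x⇒x≤y (≤-respʳ
                        (solve 3 (λ a b c → c :- b := a :- ((a :+ b) :- c)) refl u x y)
                        (x≤y⇒0≤y-x x≤y)) ⟩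
      u            ∎)

    +-pos-nonNeg : ∀ {x y} → 0# < x → 0# ≤ y → 0# < x + y
    +-pos-nonNeg 0<x 0≤y = <-respˡ (+-identityˡ 0#) (+-mono-<-≤ 0<x 0≤y)

    *-monoˡ-≤-nonNeg : ∀ {a x y} → 0# ≤ a → x ≤ y → a * x ≤ a * y
    *-monoˡ-≤-nonNeg {a} {x} {y} 0≤a x≤y = 0≤y-x⇒x≤y (≤-respʳ
      (solve 3 (λ a x y → a :* (y :- x) := a :* y :- a :* x) refl a x y)
      (*-nonNeg 0≤a (x≤y⇒0≤y-x x≤y)))

    *-cancelˡ-≈ : ∀ {a x y} → a ≉ 0# → a * x ≈ a * y → x ≈ y
    *-cancelˡ-≈ {a} {x} {y} a≉0 ax≈ay = begin-equality
      x               ≈⟨ *-identityˡ x ⟨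
      1# * x          ≈⟨ *-congʳ (⁻¹-inverseʳ a≉0) ⟨
      a * a ⁻¹ * x    ≈⟨ solve 3 (λ a b x → a :* b :* x := b :* (a :* x)) refl a (a ⁻¹) x ⟩
      a ⁻¹ * (a * x)  ≈⟨ *-congˡ ax≈ay ⟩
      a ⁻¹ * (a * y)  ≈⟨ solve 3 (λ a b x → b :* (a :* x) := a :* b :* x) refl a (a ⁻¹) y ⟩
      a * a ⁻¹ * y    ≈⟨ *-congʳ (⁻¹-inverseʳ a≉0) ⟩
      1# * y          ≈⟨ *-identityˡ y ⟩
      y               ∎

    *-pos : ∀ {x y} → 0# < x → 0# < y → 0# < x * y
    *-pos {x} {y} 0<x 0<y = *-nonNeg (<⇒≤ 0<x) (<⇒≤ 0<y) , λ 0≈xy →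
      proj₂ 0<y (sym (*-cancelˡ-≈ (proj₂ 0<x ∘ sym) (trans (sym 0≈xy) (sym (zeroʳ x)))))

    *-monoˡ-<-pos : ∀ {a x y} → 0# < a → x < y → a * x < a * y
    *-monoˡ-<-pos {a} {x} {y} 0<a x<y = 0<y-x⇒x<y (<-respʳ
      (solve 3 (λ a x y → a :* (y :- x) := a :* y :- a :* x) refl a x y)
      (*-pos 0<a (x<y⇒0<y-x x<y)))

    *-cancelˡ-≤-pos : ∀ {a x y} → 0# < a → a * x ≤ a * y → x ≤ y
    *-cancelˡ-≤-pos 0<a ax≤ay = ≮⇒≥ λ y<x → <⇒≱ (*-monoˡ-<-pos 0<a y<x) ax≤ay

    *-mono-<-nonNeg : ∀ {x y} → 0# ≤ x → x < y → x * x < y * y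
    *-mono-<-nonNeg 0≤x x<y = ≤-<-trans (*-monoˡ-≤-nonNeg 0≤x (<⇒≤ x<y))
      (<-respˡ (*-comm _ _) (*-monoˡ-<-pos (≤-<-trans 0≤x x<y) x<y))

    square-cancel-≤ : ∀ {x y} → 0# ≤ y → x * x ≤ y * y → x ≤ y
    square-cancel-≤ 0≤y xx≤yy = ≮⇒≥ λ y<x → <⇒≱ (*-mono-<-nonNeg 0≤y y<x) xx≤yy

    square-injective : ∀ {x y} → 0# ≤ x → 0# ≤ y → x * x ≈ y * y → x ≈ y
    square-injective 0≤x 0≤y eq =
      ≤-antisym (square-cancel-≤ 0≤y (≤-reflexive eq)) (square-cancel-≤ 0≤x (≤-reflexive (sym eq)))

    -x*-x≈x*x : ∀ x → - x * - x ≈ x * x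
    -x*-x≈x*x = solve 1 (λ x → :- x :* :- x := x :* x) refl

    square-nonNeg : ∀ x → 0# ≤ x * x
    square-nonNeg x with total 0# x
    ... | inj₁ 0≤x = *-nonNeg 0≤x 0≤x
    ... | inj₂ x≤0 = ≤-respʳ (-x*-x≈x*x x) (*-nonNeg (x≤0⇒0≤-x x≤0) (x≤0⇒0≤-x x≤0))

    square-pos : ∀ {x} → x ≉ 0# → 0# < x * x
    square-pos {x} x≉0 = square-nonNeg x , λ 0≈xx →
      x≉0 (*-cancelˡ-≈ x≉0 (trans (sym 0≈xx) (sym (zeroʳ x))))

    ∣x∣-nonNeg : ∀ x → 0# ≤ ∣ x ∣
    ∣x∣-nonNeg x with total 0# x
    ... | inj₁ 0≤x = 0≤x
    ... | inj₂ x≤0 = x≤0⇒0≤-x x≤0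

    ∣x∣*∣x∣≈x*x : ∀ x → ∣ x ∣ * ∣ x ∣ ≈ x * x
    ∣x∣*∣x∣≈x*x x with total 0# x
    ... | inj₁ 0≤x = refl
    ... | inj₂ x≤0 = -x*-x≈x*x x

    0<1 : 0# < 1#
    0<1 = <-respʳ (*-identityˡ 1#) (square-pos (0≉1 ∘ sym))

    0<2 : 0# < 1# + 1#
    0<2 = +-pos-nonNeg 0<1 (<⇒≤ 0<1)

    ⁻¹-pos : ∀ {x} → 0# < x → 0# < x ⁻¹
    ⁻¹-pos {x} 0<x = ≰⇒> λ x⁻¹≤0 → <⇒≱ 0<1 (begin
      1#        ≈⟨ ⁻¹-inverseʳ (proj₂ 0<x ∘ sym) ⟨
      x * x ⁻¹  ≤⟨ *-monoˡ-≤-nonNeg (<⇒≤ 0<x) x⁻¹≤0 ⟩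
      x * 0#    ≈⟨ zeroʳ x ⟩
      0#        ∎)

    ⁻¹-inverseˡ : ∀ {x} → x ≉ 0# → x ⁻¹ * x ≈ 1#
    ⁻¹-inverseˡ x≉0 = trans (*-comm _ _) (⁻¹-inverseʳ x≉0)

    0<½ : 0# < ½
    0<½ = ⁻¹-pos 0<2

    ½+½≈1 : ½ + ½ ≈ 1#
    ½+½≈1 = trans (solve 1 (λ h → h :+ h := (:1 :+ :1) :* h) refl ½) (⁻¹-inverseʳ (proj₂ 0<2 ∘ sym))

    x<x+1 : ∀ x → x < x + 1#
    x<x+1 x = 0<y-x⇒x<y (<-respʳ (solve 1 (λ x → :1 := x :+ :1 :- x) refl x) 0<1)

    dense : ∀ {x y} → x < y → ∃ λ z → x < z × z < y
    dense {x} {y} x<y =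
      x + ½ * (y - x) ,
      0<y-x⇒x<y (<-respʳ (solve 2 (λ x d → d := x :+ d :- x) refl x _) 0<d) ,
      0<y-x⇒x<y (<-respʳ eq 0<d)
      where
      0<d : 0# < ½ * (y - x)
      0<d = *-pos 0<½ (x<y⇒0<y-x x<y)
      eq : ½ * (y - x) ≈ y - (x + ½ * (y - x))
      eq = begin-equality
        ½ * (y - x)                        ≈⟨ solve 3 (λ x y h → h :* (y :- x) :=
                                                (h :+ h) :* (y :- x) :- h :* (y :- x)) refl x y ½ ⟩
        (½ + ½) * (y - x) - ½ * (y - x)    ≈⟨ +-congʳ (*-congʳ ½+½≈1) ⟩
        1# * (y - x) - ½ * (y - x)         ≈⟨ solve 3 (λ x y h → :1 :* (y :- x) :- h :* (y :- x) :=
                                                y :- (x :+ h :* (y :- x))) refl x y ½ ⟩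
        y - (x + ½ * (y - x))              ∎

    -- The root is the supremum `s` of the nonnegative numbers with square at most `c`. If its
    -- square were below `c`, a slightly larger number would still belong to the set; if above,
    -- there would be a smaller upper bound.
    sqrt : ∀ {c} → 0# ≤ c → ∃ λ r → 0# ≤ r × r * r ≈ c
    sqrt {c} 0≤c = s , 0≤s , ≤-antisym (≮⇒≥ not-above) (≮⇒≥ not-below)
      where
      S : Pred ℝ 0ℓ
      S x = 0# ≤ x × x * x ≤ c

      0∈S : S 0#
      0∈S = ≤-refl , ≤-respˡ (sym (zeroˡ 0#)) 0≤c

      below-1+c : UpperBound S (1# + c)
      below-1+c {x} (0≤x , xx≤c) = square-cancel-≤ (+-nonNeg (<⇒≤ 0<1) 0≤c) (≤-trans xx≤c
        (0≤y-x⇒x≤y (≤-respʳ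
          (solve 1 (λ c → :1 :+ c :+ c :* c := (:1 :+ c) :* (:1 :+ c) :- c) refl c)
          (+-nonNeg (+-nonNeg (<⇒≤ 0<1) 0≤c) (square-nonNeg c)))))

      supremum : ∃ λ s → UpperBound S s × (∀ {b} → UpperBound S b → s ≤ b)
      supremum = complete S (0# , 0∈S) (1# + c , below-1+c)

      s : ℝ
      s = proj₁ supremum

      s-upper : UpperBound S s
      s-upper = proj₁ (proj₂ supremum)

      s-least : ∀ {b} → UpperBound S b → s ≤ b
      s-least = proj₂ (proj₂ supremum)

      0≤s : 0# ≤ s
      0≤s = s-upper 0∈S

      not-below : ¬ (s * s < c)
      not-below ss<c = <⇒≱ (0<y-x⇒x<y (<-respʳ (solve 2 (λ s δ → δ := s :+ δ :- s) refl s δ) 0<δ))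
        (s-upper (+-nonNeg 0≤s (<⇒≤ 0<δ) , 0≤y-x⇒x≤y (≤-respʳ eq
          (*-nonNeg (<⇒≤ 0<δ) (+-nonNeg (x≤y⇒0≤y-x δ≤1) (<⇒≤ 0<D))))))
        where
        D : ℝ
        D = c - s * s
        0<D : 0# < D
        0<D = x<y⇒0<y-x ss<c
        -- Dividing the defect `D` by `K` makes the increment `δ` at most 1 and leaves c - (s + δ)²
        -- equal to the nonnegative number δ((1 - δ) + D).
        K : ℝ
        K = 1# + (s + s + D)
        0<K : 0# < K
        0<K = +-pos-nonNeg 0<1 (+-nonNeg (+-nonNeg 0≤s 0≤s) (<⇒≤ 0<D))
        δ : ℝ
        δ = D * K ⁻¹
        0<δ : 0# < δ
        0<δ = *-pos 0<D (⁻¹-pos 0<K)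
        Kδ≈D : K * δ ≈ D
        Kδ≈D = begin-equality
          K * (D * K ⁻¹)  ≈⟨ solve 3 (λ k d i → k :* (d :* i) := d :* (k :* i)) refl K D (K ⁻¹) ⟩
          D * (K * K ⁻¹)  ≈⟨ *-congˡ (⁻¹-inverseʳ (proj₂ 0<K ∘ sym)) ⟩
          D * 1#          ≈⟨ *-identityʳ D ⟩
          D               ∎
        δ≤1 : δ ≤ 1#
        δ≤1 = *-cancelˡ-≤-pos 0<K (begin
          K * δ   ≈⟨ Kδ≈D ⟩
          D       ≤⟨ 0≤y-x⇒x≤y (≤-respʳ
                       (solve 2 (λ s d → :1 :+ (s :+ s) := (:1 :+ (s :+ s :+ d)) :* :1 :- d) refl s D)
                       (+-nonNeg (<⇒≤ 0<1) (+-nonNeg 0≤s 0≤s))) ⟩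
          K * 1#  ∎)
        eq : δ * ((1# - δ) + D) ≈ c - (s + δ) * (s + δ)
        eq = begin-equality
          δ * ((1# - δ) + D)                ≈⟨ solve 3 (λ s δ D → δ :* ((:1 :- δ) :+ D) :=
                                                 (:1 :+ (s :+ s :+ D)) :* δ :- (δ :* (s :+ s) :+ δ :* δ)) refl s δ D ⟩
          K * δ - (δ * (s + s) + δ * δ)     ≈⟨ +-congʳ Kδ≈D ⟩
          D - (δ * (s + s) + δ * δ)
            ≈⟨ solve 3 (λ s δ c → (c :- s :* s) :- (δ :* (s :+ s) :+ δ :* δ) :=
                 c :- (s :+ δ) :* (s :+ δ)) refl s δ c ⟩
          c - (s + δ) * (s + δ)             ∎

      not-above : ¬ (c < s * s)
      not-above c<ss = <⇒≱ r<s (s-least λ {x} (0≤x , xx≤c) → square-cancel-≤ (<⇒≤ 0<r) (≤-trans xx≤c c≤rr))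
        where
        0<s : 0# < s
        0<s = 0≤s , λ 0≈s → <⇒≱ c<ss (≤-respˡ (trans (sym (zeroˡ s)) (*-congʳ 0≈s)) 0≤c)
        i : ℝ
        i = s ⁻¹
        si≈1 : s * i ≈ 1#
        si≈1 = ⁻¹-inverseʳ (proj₂ 0<s ∘ sym)
        -- One Newton step from s.
        r : ℝ
        r = ½ * (s + c * i)
        0<r : 0# < r
        0<r = *-pos 0<½ (+-pos-nonNeg 0<s (*-nonNeg 0≤c (<⇒≤ (⁻¹-pos 0<s))))
        s-r : ½ * (i * (s * s - c)) ≈ s - r
        s-r = begin-equality
          ½ * (i * (s * s - c))            ≈⟨ solve 4 (λ s i c h → h :* (i :* (s :* s :- c)) :=
                                                h :* (s :* i :* s) :- h :* (c :* i)) refl s i c ½ ⟩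
          ½ * (s * i * s) - ½ * (c * i)    ≈⟨ +-congʳ (*-congˡ (*-congʳ si≈1)) ⟩
          ½ * (1# * s) - ½ * (c * i)
            ≈⟨ solve 4 (λ s i c h → h :* (:1 :* s) :- h :* (c :* i) :=
                 (h :+ h) :* s :- h :* (s :+ c :* i)) refl s i c ½ ⟩
          (½ + ½) * s - r                  ≈⟨ +-congʳ (trans (*-congʳ ½+½≈1) (*-identityˡ s)) ⟩
          s - r                            ∎
        r<s : r < s
        r<s = 0<y-x⇒x<y (<-respʳ s-r (*-pos 0<½ (*-pos (⁻¹-pos 0<s) (x<y⇒0<y-x c<ss))))
        rr-c : (½ * (s - c * i)) * (½ * (s - c * i)) ≈ r * r - c
        rr-c = begin-equality
          (½ * (s - c * i)) * (½ * (s - c * i))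
            ≈⟨ solve 4 (λ s i c h → (h :* (s :- c :* i)) :* (h :* (s :- c :* i)) :=
                 (h :* (s :+ c :* i)) :* (h :* (s :+ c :* i)) :- (h :+ h) :* (h :+ h) :* (c :* (s :* i)))
                 refl s i c ½ ⟩
          r * r - (½ + ½) * (½ + ½) * (c * (s * i))
            ≈⟨ +-congˡ (-‿cong (*-cong (*-cong ½+½≈1 ½+½≈1) (*-congˡ si≈1))) ⟩
          r * r - 1# * 1# * (c * 1#)
            ≈⟨ solve 2 (λ r c → r :* r :- :1 :* :1 :* (c :* :1) := r :* r :- c) refl r c ⟩
          r * r - c
            ∎
        c≤rr : c ≤ r * r
        c≤rr = 0≤y-x⇒x≤y (≤-respʳ rr-c (square-nonNeg _))

    argmax : ∀ {m} (g : Fin (ℕ.suc m) → ℝ) → ∃ λ i → ∀ j → g j ≤ g i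
    argmax {ℕ.zero}  g = zero , λ { zero → ≤-refl }
    argmax {ℕ.suc m} g with argmax (g ∘ suc)
    ... | i , g≤gi with total (g zero) (g (suc i))
    ...   | inj₁ g0≤gi = suc i , λ { zero → g0≤gi ; (suc j) → g≤gi j }
    ...   | inj₂ gi≤g0 = zero , λ { zero → ≤-refl ; (suc j) → ≤-trans (g≤gi j) gi≤g0 }

    upperBound : ∀ {m} (g : Fin m → ℝ) → ∃ λ t → 0# ≤ t × (∀ i → g i ≤ t)
    upperBound {ℕ.zero}  g = 0# , ≤-refl , λ ()
    upperBound {ℕ.suc m} g with argmax g
    ... | i , g≤gi with total 0# (g i)
    ...   | inj₁ 0≤gi = g i , 0≤gi , g≤gi
    ...   | inj₂ gi≤0 = 0# , ≤-refl , λ j → ≤-trans (g≤gi j) gi≤0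

    -- One parameter is taken large enough for finitely many linear constraints. It serves both for
    -- the elongation of an ellipsoid and for the length of a translation.
    dominate : ∀ {m} (r c : Fin m → ℝ) → (∀ i → 0# < c i) →
               ∃ λ t → 0# ≤ t × (∀ i → r i ≤ t * c i)
    dominate r c 0<c with upperBound (λ i → r i * c i ⁻¹)
    ... | t , 0≤t , r/c≤t = t , 0≤t , λ i → begin
      r i                ≈⟨ *-identityʳ _ ⟨
      r i * 1#           ≈⟨ *-congˡ (⁻¹-inverseʳ (proj₂ (0<c i) ∘ sym)) ⟨
      r i * (c i * c i ⁻¹)
        ≈⟨ solve 3 (λ r c d → r :* (c :* d) := c :* (r :* d)) refl (r i) (c i) _ ⟩
      c i * (r i * c i ⁻¹) ≤⟨ *-monoˡ-≤-nonNeg (<⇒≤ (0<c i)) (r/c≤t i) ⟩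
      c i * t            ≈⟨ *-comm _ _ ⟩
      t * c i            ∎

-- The standard inner product and the standard basis.

module InnerProduct (lem : ExcludedMiddle 0ℓ) (R : CompleteOrderedField) where

  open CompleteOrderedField R hiding (zero)
  open Geometry R
  open OrderedField lem R
  open RingSolver commutativeRing
  open ≤-Reasoning
  open import Algebra.Properties.CommutativeMonoid.Sum +-commutativeMonoid public
    using (∑-distrib-+; sum-cong-≋)
  open import Algebra.Properties.Monoid.Sum +-monoid public using (sum-replicate-zero)
  open import Algebra.Properties.Semiring.Sum semiring public using (*-distribˡ-sum)

  infix 7 _∙_

  _∙_ : ∀ {d} → Point d → Point d → ℝ
  f ∙ x = sum (λ j → f j * x j)

  ∙-congˡ : ∀ {d} (f : Point d) {x y} → x ≋ y → f ∙ x ≈ f ∙ y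
  ∙-congˡ f x≋y = sum-cong-≋ λ j → *-congˡ (x≋y j)

  ∙-distribˡ-+ᵥ : ∀ {d} (f x y : Point d) → f ∙ (x +ᵥ y) ≈ f ∙ x + f ∙ y
  ∙-distribˡ-+ᵥ f x y =
    trans (sum-cong-≋ λ j → distribˡ (f j) (x j) (y j)) (∑-distrib-+ (λ j → f j * x j) (λ j → f j * y j))

  ∙-homo-· : ∀ {d} (f : Point d) a x → f ∙ (a · x) ≈ a * (f ∙ x)
  ∙-homo-· f a x = trans
    (sum-cong-≋ λ j → solve 3 (λ f a x → f :* (a :* x) := a :* (f :* x)) refl (f j) a (x j))
    (sym (*-distribˡ-sum a (λ j → f j * x j)))

  ∙-comm : ∀ {d} (x y : Point d) → x ∙ y ≈ y ∙ x
  ∙-comm x y = sum-cong-≋ λ j → *-comm (x j) (y j)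

  ∙-distribˡ--ᵥ : ∀ {d} (f x y : Point d) → f ∙ (x -ᵥ y) ≈ f ∙ x - f ∙ y
  ∙-distribˡ--ᵥ f x y = begin-equality
    f ∙ (x -ᵥ y)
      ≈⟨ ∙-congˡ f (λ j → solve 2 (λ x y → x :- y := x :+ (:- :1) :* y) refl (x j) (y j)) ⟩
    f ∙ (x +ᵥ (- 1#) · y)       ≈⟨ ∙-distribˡ-+ᵥ f x _ ⟩
    f ∙ x + f ∙ ((- 1#) · y)    ≈⟨ +-congˡ (∙-homo-· f (- 1#) y) ⟩
    f ∙ x + - 1# * (f ∙ y)
      ≈⟨ solve 2 (λ x y → x :+ (:- :1) :* y := x :- y) refl (f ∙ x) (f ∙ y) ⟩
    f ∙ x - f ∙ y               ∎

  sum-nonNeg : ∀ {k} (w : Fin k → ℝ) → (∀ i → 0# ≤ w i) → 0# ≤ sum w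
  sum-nonNeg {ℕ.zero}  w 0≤w = ≤-refl
  sum-nonNeg {ℕ.suc k} w 0≤w = +-nonNeg (0≤w zero) (sum-nonNeg (w ∘ suc) (0≤w ∘ suc))

  term≤sum : ∀ {k} (w : Fin k → ℝ) → (∀ i → 0# ≤ w i) → ∀ i → w i ≤ sum w
  term≤sum {ℕ.suc k} w 0≤w zero =
    ≤-respˡ (+-identityʳ _) (+-mono-≤ ≤-refl (sum-nonNeg (w ∘ suc) (0≤w ∘ suc)))
  term≤sum {ℕ.suc k} w 0≤w (suc i) =
    ≤-respˡ (+-identityˡ _) (+-mono-≤ (0≤w zero) (term≤sum (w ∘ suc) (0≤w ∘ suc) i))

  x∙x-nonNeg : ∀ {d} (x : Point d) → 0# ≤ x ∙ x
  x∙x-nonNeg x = sum-nonNeg _ λ j → square-nonNeg (x j)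

  x∙x≤0⇒x≋0 : ∀ {d} {x : Point d} → x ∙ x ≤ 0# → x ≋ 0ᵥ
  x∙x≤0⇒x≋0 {x = x} x∙x≤0 j with lem {x j ≈ 0#}
  ... | yes xj≈0 = xj≈0
  ... | no  xj≉0 = ⊥-elim (<⇒≱ (square-pos xj≉0)
    (≤-trans (term≤sum _ (λ i → square-nonNeg (x i)) j) x∙x≤0))

  unit : ∀ {d} → Fin d → Point d
  unit zero    = 1# Vector.∷ 0ᵥ
  unit (suc j) = 0# Vector.∷ unit j

  0∙x≈0 : ∀ {d} (x : Point d) → 0ᵥ ∙ x ≈ 0#
  0∙x≈0 {d} x = trans (sum-cong-≋ λ j → zeroˡ (x j)) (sum-replicate-zero d)

  unit-∙ : ∀ {d} (j : Fin d) x → unit j ∙ x ≈ x j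
  unit-∙ zero x = trans (+-cong (*-identityˡ _) (0∙x≈0 (x ∘ suc))) (+-identityʳ _)
  unit-∙ (suc j) x = trans (+-cong (zeroˡ _) (unit-∙ j (x ∘ suc))) (+-identityˡ _)

  unit-nonNeg : ∀ {d} (j : Fin d) i → 0# ≤ unit j i
  unit-nonNeg zero    zero    = <⇒≤ 0<1
  unit-nonNeg zero    (suc i) = ≤-refl
  unit-nonNeg (suc j) zero    = ≤-refl
  unit-nonNeg (suc j) (suc i) = unit-nonNeg j i

-- Gordan's alternative and separation of convexly independent points.

module Separation (lem : ExcludedMiddle 0ℓ) (R : CompleteOrderedField) where

  open CompleteOrderedField R hiding (zero)
  open Geometry R
  open OrderedField lem R
  open InnerProduct lem R
  open RingSolver commutativeRing
  open ≤-Reasoning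

  -- The empty combination is excluded, so 0ᵥ ∈ Cone S is a nontrivial relation.
  data Cone {d} (S : Pred (Point d) 0ℓ) : Pred (Point d) 0ℓ where
    gen   : ∀ {v} → S v → Cone S v
    add   : ∀ {u v} → Cone S u → Cone S v → Cone S (u +ᵥ v)
    scale : ∀ {a v} → 0# < a → Cone S v → Cone S (a · v)
    resp  : ∀ {u v} → u ≋ v → Cone S u → Cone S v

  above : ∀ l (us : List ℝ) → (∀ {u} → u ∈ us → l < u) → ∃ λ g → l < g × (∀ {u} → u ∈ us → g < u)
  above l []       l<us = l + 1# , x<x+1 l , λ ()
  above l (u ∷ us) l<us with above l us (l<us ∘ there)
  ... | g , l<g , g<us with lem {g < u}
  ...   | yes g<u = g , l<g , λ { (here ≡.refl) → g<u ; (there u∈us) → g<us u∈us }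
  ...   | no  g≮u with dense (l<us (here ≡.refl))
  ...     | m , l<m , m<u = m , l<m , λ
    { (here ≡.refl) → m<u
    ; (there u∈us)  → <-trans (<-≤-trans m<u (≮⇒≥ g≮u)) (g<us u∈us)
    }

  lowerThan : (us : List ℝ) → ∃ λ l → ∀ {u} → u ∈ us → l < u
  lowerThan []       = 0# , λ ()
  lowerThan (u ∷ us) with lowerThan us
  ... | l , l<us with lem {l < u}
  ...   | yes l<u = l , λ { (here ≡.refl) → l<u ; (there u∈us) → l<us u∈us }
  ...   | no  l≮u = u - 1# , λ
    { (here ≡.refl) → u-1<u
    ; (there u∈us)  → <-trans (<-≤-trans u-1<u (≮⇒≥ l≮u)) (l<us u∈us)
    }
    where
    u-1<u : u - 1# < u
    u-1<u = <-respʳ (solve 1 (λ u → u :- :1 :+ :1 := u) refl u) (x<x+1 (u - 1#))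

  -- Strict inequalities in one unknown are solved by adding the lower bounds one at a time: moving
  -- a solution up past a violated bound `l` keeps the earlier lower bounds, and density leaves room
  -- below all upper bounds.
  between : (ls us : List ℝ) → (∀ {l u} → l ∈ ls → u ∈ us → l < u) →
            ∃ λ g → (∀ {l} → l ∈ ls → l < g) × (∀ {u} → u ∈ us → g < u)
  between []       us _     with lowerThan us
  ... | g , g<us = g , (λ ()) , g<us
  between (l ∷ ls) us ls<us with between ls us (ls<us ∘ there)
  ... | g , ls<g , g<us with lem {l < g}
  ...   | yes l<g = g , (λ { (here ≡.refl) → l<g ; (there l∈ls) → ls<g l∈ls }) , g<us
  ...   | no  l≮g with above l us (ls<us (here ≡.refl))
  ...     | m , l<m , m<us = m , (λ
    { (here ≡.refl) → l<m
    ; (there l∈ls)  → <-trans (ls<g l∈ls) (≤-<-trans (≮⇒≥ l≮g) l<m)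
    }) , m<us

  -- For `p zero` positive and `n zero` negative, this is the tail of a combination of `p` and `n`
  -- with positive coefficients whose first coordinate cancels.
  eliminate : ∀ {d} → Point (ℕ.suc d) → Point (ℕ.suc d) → Point d
  eliminate p n = (- n zero) · (p ∘ suc) +ᵥ p zero · (n ∘ suc)

  module Elimination {d} (vs : List (Point (ℕ.suc d))) where

    pos? : ∀ (v : Point (ℕ.suc d)) → Dec (0# < v zero)
    pos? _ = lem
    neg? : ∀ (v : Point (ℕ.suc d)) → Dec (v zero < 0#)
    neg? _ = lem
    nil? : ∀ (v : Point (ℕ.suc d)) → Dec (v zero ≈ 0#)
    nil? _ = lem

    ps = filter pos? vs
    ns = filter neg? vs
    zs = filter nil? vs
    vs′ = map (_∘ suc) zs List.++ cartesianProductWith eliminate ps ns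

    -- With a first coordinate 0 restored, each vector of `vs′` is a positive combination of at most
    -- two vectors of `vs`. Hence a vanishing combination found after the elimination gives one
    -- before it.
    lift : ∀ {u} → Cone (_∈ vs′) u → Cone (_∈ vs) (0# Vector.∷ u)
    lift (add {u} {v} cu cv) =
      resp (λ { zero → +-identityˡ 0# ; (suc j) → refl }) (add (lift cu) (lift cv))
    lift (scale {a} 0<a c) =
      resp (λ { zero → zeroʳ a ; (suc j) → refl }) (scale 0<a (lift c))
    lift (resp u≋v c) = resp (λ { zero → refl ; (suc j) → u≋v j }) (lift c)
    lift (gen u∈vs′) with ∈-++⁻ (map (_∘ suc) zs) u∈vs′
    ... | inj₁ u∈zs′ with v , v∈zs , ≡.refl ← ∈-map⁻ (_∘ suc) u∈zs′
                     with v∈vs , v0≈0 ← ∈-filter⁻ nil? {xs = vs} v∈zs =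
      resp (λ { zero → v0≈0 ; (suc j) → refl }) (gen v∈vs)
    ... | inj₂ u∈pns with p , n , p∈ps , n∈ns , ≡.refl ← ∈-cartesianProductWith⁻ eliminate ps ns u∈pns
                     with p∈vs , 0<p0 ← ∈-filter⁻ pos? {xs = vs} p∈ps
                        | n∈vs , n0<0 ← ∈-filter⁻ neg? {xs = vs} n∈ns =
      resp (λ { zero    → solve 2 (λ p n → :- n :* p :+ p :* n := :0) refl (p zero) (n zero)
              ; (suc j) → refl })
        (add (scale (x<0⇒0<-x n0<0) (gen p∈vs)) (scale 0<p0 (gen n∈vs)))

    module Extension (f : Point d) (0<f : ∀ {u} → u ∈ vs′ → 0# < f ∙ u) where

      -- The condition 0# < (g ∷ f) ∙ v bounds g by bound v, from below or from
      -- above according to the sign of v zero.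
      bound : Point (ℕ.suc d) → ℝ
      bound v = - (f ∙ (v ∘ suc)) * v zero ⁻¹

      bound-* : ∀ v → v zero ≉ 0# → v zero * bound v ≈ - (f ∙ (v ∘ suc))
      bound-* v v0≉0 = begin-equality
        v zero * (- F * v zero ⁻¹)
          ≈⟨ solve 3 (λ a F b → a :* (:- F :* b) := :- F :* (a :* b)) refl (v zero) F (v zero ⁻¹) ⟩
        - F * (v zero * v zero ⁻¹)  ≈⟨ *-congˡ (⁻¹-inverseʳ v0≉0) ⟩
        - F * 1#                    ≈⟨ *-identityʳ (- F) ⟩
        - F                         ∎
        where F = f ∙ (v ∘ suc)

      -- The value of `f` at `eliminate p n` is the positive number `p zero * - n zero` times
      -- `bound n - bound p`, so its positivity says exactly that the lower bound is below the upper
      -- one.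
      bounds : ∀ {l u} → l ∈ map bound ps → u ∈ map bound ns → l < u
      bounds l∈ u∈
        with p , p∈ps , ≡.refl ← ∈-map⁻ bound l∈
           | n , n∈ns , ≡.refl ← ∈-map⁻ bound u∈
        with p∈vs , 0<p0 ← ∈-filter⁻ pos? {xs = vs} p∈ps
           | n∈vs , n0<0 ← ∈-filter⁻ neg? {xs = vs} n∈ns =
        ≰⇒> λ bn≤bp → <⇒≱ (0<f (∈-++⁺ʳ (map (_∘ suc) zs) (∈-cartesianProductWith⁺ eliminate p∈ps n∈ns))) (begin
          f ∙ eliminate p n
            ≈⟨ trans (∙-distribˡ-+ᵥ f _ _) (+-cong (∙-homo-· f _ _) (∙-homo-· f _ _)) ⟩
          - n zero * P + p zero * N
            ≈⟨ solve 4 (λ n P p N → :- n :* P :+ p :* N := n :* (:- P) :+ :- (p :* (:- N))) refl (n zero) P (p zero) N ⟩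
          n zero * - P - p zero * - N
            ≈⟨ +-cong (*-congˡ (bound-* p (proj₂ 0<p0 ∘ sym))) (-‿cong (*-congˡ (bound-* n (proj₂ n0<0)))) ⟨
          n zero * (p zero * bound p) - p zero * (n zero * bound n)
            ≈⟨ solve 4 (λ n bp p bn → n :* (p :* bp) :- p :* (n :* bn) := :- (p :* (:- n) :* (bp :- bn)))
                 refl (n zero) (bound p) (p zero) (bound n) ⟩
          - (p zero * - n zero * (bound p - bound n))
            ≤⟨ 0≤y-x⇒x≤y (≤-respʳ (solve 1 (λ x → x := :0 :- :- x) refl _)
                 (*-nonNeg (<⇒≤ (*-pos 0<p0 (x<0⇒0<-x n0<0))) (x≤y⇒0≤y-x bn≤bp))) ⟩
          0#
            ∎)
        where
        P = f ∙ (p ∘ suc)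
        N = f ∙ (n ∘ suc)

      choice = between (map bound ps) (map bound ns) bounds
      g = proj₁ choice

      positive : ∀ {v} → v ∈ vs → 0# < (g Vector.∷ f) ∙ v
      positive {v} v∈vs with lem {v zero ≈ 0#}
      ... | yes v0≈0 = <-respʳ
        (sym (trans (+-congʳ (trans (*-congˡ v0≈0) (zeroʳ g))) (+-identityˡ _)))
        (0<f (∈-++⁺ˡ (∈-map⁺ (_∘ suc) (∈-filter⁺ nil? v∈vs v0≈0))))
      ... | no  v0≉0 with total 0# (v zero)
      ...   | inj₁ 0≤v0 = <-respʳ (begin-equality
          v zero * (g - bound v)
            ≈⟨ solve 3 (λ v g b → v :* (g :- b) := g :* v :- v :* b) refl (v zero) g (bound v) ⟩
          g * v zero - v zero * bound v  ≈⟨ +-congˡ (-‿cong (bound-* v v0≉0)) ⟩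
          g * v zero - - F               ≈⟨ solve 2 (λ a F → a :- :- F := a :+ F) refl _ F ⟩
          g * v zero + F                 ∎)
          (*-pos 0<v0 (x<y⇒0<y-x (proj₁ (proj₂ choice) (∈-map⁺ bound (∈-filter⁺ pos? v∈vs 0<v0)))))
          where
          F = f ∙ (v ∘ suc)
          0<v0 : 0# < v zero
          0<v0 = 0≤v0 , v0≉0 ∘ sym
      ...   | inj₂ v0≤0 = <-respʳ (begin-equality
          - v zero * (bound v - g)
            ≈⟨ solve 3 (λ v g b → :- v :* (b :- g) := g :* v :- v :* b) refl (v zero) g (bound v) ⟩
          g * v zero - v zero * bound v  ≈⟨ +-congˡ (-‿cong (bound-* v v0≉0)) ⟩
          g * v zero - - F               ≈⟨ solve 2 (λ a F → a :- :- F := a :+ F) refl _ F ⟩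
          g * v zero + F                 ∎)
          (*-pos (x<0⇒0<-x v0<0) (x<y⇒0<y-x (proj₂ (proj₂ choice) (∈-map⁺ bound (∈-filter⁺ neg? v∈vs v0<0)))))
          where
          F = f ∙ (v ∘ suc)
          v0<0 : v zero < 0#
          v0<0 = v0≤0 , v0≉0

  -- Gordan's theorem of the alternative, by Fourier–Motzkin elimination of the
  -- first coordinate.
  gordan : ∀ {d} (vs : List (Point d)) → Cone (_∈ vs) 0ᵥ ⊎ ∃ λ f → ∀ {v} → v ∈ vs → 0# < f ∙ v
  gordan {ℕ.zero}  []       = inj₂ (0ᵥ , λ ())
  -- In dimension 0 every vector is the zero vector, so a single generator already gives a
  -- nontrivial relation.
  gordan {ℕ.zero}  (v ∷ vs) = inj₁ (resp (λ ()) (gen (here ≡.refl)))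
  gordan {ℕ.suc d} vs       with gordan (Elimination.vs′ vs)
  ... | inj₁ c         = inj₁ (resp (λ { zero → refl ; (suc j) → refl }) (Elimination.lift vs c))
  ... | inj₂ (f , 0<f) = inj₂ (g Vector.∷ f , positive)
    where open Elimination.Extension vs f 0<f

  -- The total weight is kept positive so that it can be divided out later, turning the weights into
  -- those of a convex combination.
  cone⇒combination : ∀ {d m} (z : Fin m → Point d) {x} → Cone (λ v → ∃ λ b → v ≡ z b) x →
    ∃ λ w → (∀ b → 0# ≤ w b) × 0# < sum w × x ≋ linearCombination w z
  cone⇒combination z (gen (b , ≡.refl)) =
    unit b , unit-nonNeg b ,
    <-≤-trans (<-respʳ (sym (unit-self b)) 0<1) (term≤sum (unit b) (unit-nonNeg b) b) ,
    λ j → sym (unit-∙ b (λ c → z c j))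
    where
    unit-self : ∀ {m} (b : Fin m) → unit b b ≈ 1#
    unit-self zero    = refl
    unit-self (suc b) = unit-self b
  cone⇒combination z (add cu cv)
    with u , 0≤u , 0<u , eqᵤ ← cone⇒combination z cu
       | v , 0≤v , 0<v , eqᵥ ← cone⇒combination z cv =
    (λ b → u b + v b) , (λ b → +-nonNeg (0≤u b) (0≤v b)) ,
    <-respʳ (sym (∑-distrib-+ u v)) (+-pos-nonNeg 0<u (<⇒≤ 0<v)) ,
    λ j → begin-equality
      _                                                ≈⟨ +-cong (eqᵤ j) (eqᵥ j) ⟩
      linearCombination u z j + linearCombination v z j
        ≈⟨ ∑-distrib-+ (λ b → u b * z b j) (λ b → v b * z b j) ⟨
      sum (λ b → u b * z b j + v b * z b j)
        ≈⟨ sum-cong-≋ (λ b → distribʳ (z b j) (u b) (v b)) ⟨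
      sum (λ b → (u b + v b) * z b j)                  ∎
  cone⇒combination z (scale {a} 0<a c)
    with w , 0≤w , 0<w , eq ← cone⇒combination z c =
    (λ b → a * w b) , (λ b → *-nonNeg (<⇒≤ 0<a) (0≤w b)) ,
    <-respʳ (*-distribˡ-sum a w) (*-pos 0<a 0<w) ,
    λ j → begin-equality
      _                              ≈⟨ *-congˡ (eq j) ⟩
      a * linearCombination w z j    ≈⟨ *-distribˡ-sum a (λ b → w b * z b j) ⟩
      sum (λ b → a * (w b * z b j))  ≈⟨ sum-cong-≋ (λ b → *-assoc a (w b) (z b j)) ⟨
      sum (λ b → a * w b * z b j)    ∎
  cone⇒combination z (resp u≋v c)
    with w , 0≤w , 0<w , eq ← cone⇒combination z c =
    w , 0≤w , 0<w , λ j → trans (sym (u≋v j)) (eq j)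

  Range : ∀ {d k} → (Fin k → Point d) → Pred (Point d) 0ℓ
  Range s x = ∃ λ a → x ≋ s a

  -- Convex independence of the range does not see repetitions, so injectivity is required
  -- separately; this makes `k` the number of points.
  ConvexlyIndependentFamily : ∀ {d k} → (Fin k → Point d) → Set
  ConvexlyIndependentFamily s = (∀ {a b} → s a ≋ s b → a ≡ b) × ConvexlyIndependent (Range s)

  cone-map : ∀ {d} {S T : Pred (Point d) 0ℓ} → (∀ {v} → S v → T v) → ∀ {x} → Cone S x → Cone T x
  cone-map f (gen Sv)      = gen (f Sv)
  cone-map f (add cu cv)   = add (cone-map f cu) (cone-map f cv)
  cone-map f (scale 0<a c) = scale 0<a (cone-map f c)
  cone-map f (resp eq c)   = resp eq (cone-map f c)

  abstract

    -- Gordan's alternative is applied to the differences of `s a` with the other points, which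
    -- `Fin.punchIn a` enumerates. A relation among them, divided by its total weight `σ`, would put
    -- `s a` in the convex hull of the others.
    separate : ∀ {d k} {s : Fin k → Point d} → ConvexlyIndependentFamily s → ∀ a →
               ∃ λ f → ∀ b → b ≢ a → f ∙ s b < f ∙ s a
    separate {d} {ℕ.suc k} {s} (s-inj , indep) a
      with gordan (List.tabulate λ b → s a -ᵥ s (Fin.punchIn a b))
    ... | inj₂ (f , 0<f) = f , λ b b≢a → ≡.subst (λ c → f ∙ s c < f ∙ s a)
      (Fin.punchIn-punchOut (b≢a ∘ ≡.sym))
      (0<y-x⇒x<y (<-respʳ (∙-distribˡ--ᵥ f _ _) (0<f (∈-tabulate⁺ (Fin.punchOut (b≢a ∘ ≡.sym))))))
    ... | inj₁ c with cone⇒combination _ (cone-map ∈-tabulate⁻ c)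
    ...   | w , 0≤w , 0<σ , eq = ⊥-elim (indep (a , λ _ → refl)
      ( k , (λ b → σ ⁻¹ * w b) , z
      , (λ b → *-nonNeg (<⇒≤ (⁻¹-pos 0<σ)) (0≤w b))
      , trans (sym (*-distribˡ-sum (σ ⁻¹) w)) (⁻¹-inverseˡ (proj₂ 0<σ ∘ sym))
      , (λ b → (Fin.punchIn a b , λ _ → refl) , Fin.punchInᵢ≢i a b ∘ s-inj)
      , hull))
      where
      σ : ℝ
      σ = sum w

      z : Fin k → Point d
      z = s ∘ Fin.punchIn a

      hull : s a ≋ linearCombination (λ b → σ ⁻¹ * w b) z
      hull j = begin-equality
        s a j                                          ≈⟨ *-identityˡ _ ⟨
        1# * s a j                                     ≈⟨ *-congʳ (⁻¹-inverseˡ (proj₂ 0<σ ∘ sym)) ⟨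
        σ ⁻¹ * σ * s a j                               ≈⟨ *-assoc _ _ _ ⟩
        σ ⁻¹ * (σ * s a j)
          ≈⟨ *-congˡ (trans (*-comm _ _) (*-distribˡ-sum (s a j) w)) ⟩
        σ ⁻¹ * sum (λ b → s a j * w b)                 ≈⟨ *-congˡ (sum-cong-≋ λ b →
                                                            solve 3 (λ s w z → s :* w := w :* (s :- z) :+ w :* z) refl (s a j) (w b) (z b j)) ⟩
        σ ⁻¹ * sum (λ b → w b * (s a j - z b j) + w b * z b j)
          ≈⟨ *-congˡ (∑-distrib-+ (λ b → w b * (s a j - z b j)) (λ b → w b * z b j)) ⟩
        σ ⁻¹ * (sum (λ b → w b * (s a j - z b j)) + sum (λ b → w b * z b j))
          ≈⟨ *-congˡ (trans (+-congʳ (sym (eq j))) (+-identityˡ _)) ⟩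
        σ ⁻¹ * sum (λ b → w b * z b j)
          ≈⟨ *-distribˡ-sum (σ ⁻¹) (λ b → w b * z b j) ⟩
        sum (λ b → σ ⁻¹ * (w b * z b j))
          ≈⟨ sum-cong-≋ (λ b → *-assoc (σ ⁻¹) (w b) (z b j)) ⟨
        sum (λ b → σ ⁻¹ * w b * z b j)                 ∎

-- Subsets as injective enumerations, pigeonhole and blocks of indices.

Selection : ∀ {k} → Pred (Fin k) 0ℓ → ℕ → Set
Selection {k} P k′ =
  Σ (Fin k′ → Fin k) λ ι → (∀ {a b} → ι a ≡ ι b → a ≡ b) × (∀ a → P (ι a))

skip : ∀ {k k′} (P : Pred (Fin (ℕ.suc k)) 0ℓ) → Selection (P ∘ suc) k′ → Selection P k′
skip P (ι , ι-inj , Pι) = suc ∘ ι , ι-inj ∘ Fin.suc-injective , Pι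

keep : ∀ {k k′} (P : Pred (Fin (ℕ.suc k)) 0ℓ) →
       P zero → Selection (P ∘ suc) k′ → Selection P (ℕ.suc k′)
keep {k} {k′} P P0 (ι , ι-inj , Pι) = ι⁺ , inj , Pι⁺
  where
  ι⁺ : Fin (ℕ.suc k′) → Fin (ℕ.suc k)
  ι⁺ zero    = zero
  ι⁺ (suc a) = suc (ι a)

  inj : ∀ {a b} → ι⁺ a ≡ ι⁺ b → a ≡ b
  inj {zero}  {zero}  _  = ≡.refl
  inj {suc a} {suc b} eq = ≡.cong suc (ι-inj (Fin.suc-injective eq))

  Pι⁺ : ∀ a → P (ι⁺ a)
  Pι⁺ zero    = P0
  Pι⁺ (suc a) = Pι a

split : ∀ {k} {P : Pred (Fin k) 0ℓ} → Decidable P →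
        ∃₂ λ k₁ k₂ → Selection P k₁ × Selection (∁ P) k₂ × k ≡ k₁ ℕ.+ k₂
split {ℕ.zero}  P? = 0 , 0 , ((λ ()) , (λ { {()} }) , λ ()) , ((λ ()) , (λ { {()} }) , λ ()) , ≡.refl
split {ℕ.suc k} {P} P? with split (P? ∘ suc) | P? zero
... | k₁ , k₂ , S₁ , S₂ , eq | yes P0  =
  ℕ.suc k₁ , k₂ , keep P P0 S₁ , skip (∁ P) S₂ , ≡.cong ℕ.suc eq
... | k₁ , k₂ , S₁ , S₂ , eq | no  ¬P0 =
  k₁ , ℕ.suc k₂ , skip P S₁ , keep (∁ P) ¬P0 S₂ , ≡.trans (≡.cong ℕ.suc eq) (≡.sym (ℕ.+-suc k₁ k₂))

abstract

  -- By induction on the number of colours: the class of `zero` is compared with the class obtained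
  -- among the remaining colours, and the larger is kept.
  pigeonhole : ∀ {m k} (colour : Fin k → Fin (ℕ.suc m)) →
    ∃₂ λ c k′ → Selection (λ a → colour a ≡ c) k′ × k ℕ.≤ ℕ.suc m ℕ.* k′
  pigeonhole {ℕ.zero}  {k} colour = zero , k , (id , id , only) , ℕ.m≤m+n k 0
    where
    only : ∀ a → colour a ≡ zero
    only a with zero ← colour a = ≡.refl
  pigeonhole {ℕ.suc m} {k} colour
    with k₁ , k₂ , S₁ , (ι₂ , ι₂-inj , ≢0) , ≡.refl ← split (λ a → colour a Fin.≟ zero)
    with c , k₃ , (ι₃ , ι₃-inj , ≡c) , k₂≤ ← pigeonhole (λ b → Fin.punchOut (≢0 b ∘ ≡.sym))
    with ℕ.≤-total k₃ k₁
  ... | inj₁ k₃≤k₁ = zero , k₁ , S₁ ,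
    ℕ.+-monoʳ-≤ k₁ (ℕ.≤-trans k₂≤ (ℕ.*-monoʳ-≤ (ℕ.suc m) k₃≤k₁))
  ... | inj₂ k₁≤k₃ = suc c , k₃ , (ι₂ ∘ ι₃ , ι₃-inj ∘ ι₂-inj , colour≡) , ℕ.+-mono-≤ k₁≤k₃ k₂≤
    where
    colour≡ : ∀ a → colour (ι₂ (ι₃ a)) ≡ suc c
    colour≡ a = ≡.trans (≡.sym (Fin.punchIn-punchOut (≢0 (ι₃ a) ∘ ≡.sym)))
                        (≡.cong suc (≡c a))

abstract

  -- The indices are embedded in an `m` by `h` grid whose rows are the blocks. Grid positions
  -- outside the image get the default `i₀`, so all blocks have the same size but may repeat an
  -- index.
  blocks : ∀ {m h n} → Fin n → n ℕ.≤ m ℕ.* h →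
           Σ (Fin m → Fin h → Fin n) λ b → ∀ i → ∃₂ λ c x → b c x ≡ i
  blocks {m} {h} {n} i₀ n≤mh = b , λ i →
    let c , x = Fin.remQuot {m} h (embed i)
    in c , x , b-embed i c x (≡.sym (Fin.combine-remQuot {m} h (embed i)))
    where
    embed : Fin n → Fin (m ℕ.* h)
    embed i = Fin.inject≤ i n≤mh

    b : Fin m → Fin h → Fin n
    b c x with Fin.any? (λ i → embed i Fin.≟ Fin.combine c x)
    ... | yes (i , _) = i
    ... | no  _       = i₀

    b-embed : ∀ i c x → embed i ≡ Fin.combine c x → b c x ≡ i
    b-embed i c x eq with Fin.any? (λ i → embed i Fin.≟ Fin.combine c x)
    ... | yes (j , eq′) = Fin.inject≤-injective n≤mh n≤mh j i (≡.trans eq′ (≡.sym eq))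
    ... | no  ∄i        = ⊥-elim (∄i (i , eq))

-- Building point sets of prescribed size.

module PointSets (lem : ExcludedMiddle 0ℓ) (R : CompleteOrderedField) where

  open CompleteOrderedField R hiding (zero)
  open Geometry R
  open OrderedField lem R

  ≋-refl : ∀ {d} {x : Point d} → x ≋ x
  ≋-refl j = refl

  pointSet : ∀ {d n} (z : Fin n → Point d) → (∀ {i j} → z i ≋ z j → i ≡ j) → PointSet d n
  pointSet z inj = record { to = z ; cong = λ { ≡.refl → ≋-refl } ; injective = inj }

  abstract

    -- The index of type `Fin d` witnesses that the dimension is positive; a point exceeding all the
    -- given ones in that coordinate is new.
    fresh : ∀ {d m} → Fin d → (z : Fin m → Point d) → ∃ λ x → ∀ i → ¬ (x ≋ z i)
    fresh j z with upperBound (λ i → z i j)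
    ... | t , _ , z≤t = (λ _ → t + 1#) , λ i x≋zi →
      <⇒≱ (x<x+1 t) (≤-respˡ (sym (x≋zi j)) (z≤t i))

  insert : ∀ {d n} (P : PointSet d n) x → ¬ ⟦ P ⟧ x → PointSet d (ℕ.suc n)
  insert {d} {n} P x x∉P = pointSet z inj
    where
    z : Fin (ℕ.suc n) → Point d
    z zero    = x
    z (suc i) = Injection.to P i

    inj : ∀ {i j} → z i ≋ z j → i ≡ j
    inj {zero}  {zero}  _  = ≡.refl
    inj {zero}  {suc j} eq = ⊥-elim (x∉P (j , eq))
    inj {suc i} {zero}  eq = ⊥-elim (x∉P (i , ≋-sym eq))
    inj {suc i} {suc j} eq = ≡.cong suc (Injection.injective P eq)

  abstract

    -- A point set has exactly `n` distinct points, whereas the family may have repetitions; each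
    -- repeated value is replaced by a fresh point.
    cover : ∀ {d n} → Fin d → (z : Fin n → Point d) → Σ (PointSet d n) λ P → ∀ i → ⟦ P ⟧ (z i)
    cover {n = ℕ.zero}  j₀ z = pointSet z (λ { {()} }) , λ ()
    cover {n = ℕ.suc n} j₀ z with P , z∈P ← cover j₀ (z ∘ suc) with lem {⟦ P ⟧ (z zero)}
    ... | no  z₀∉P = insert P (z zero) z₀∉P , λ
      { zero    → zero , ≋-refl
      ; (suc i) → let j , eq = z∈P i in suc j , eq
      }
    ... | yes (j , z₀≋) with x , x≉ ← fresh j₀ (Injection.to P) =
      insert P x (λ (i , x≋) → x≉ i x≋) , λ
      { zero    → suc j , z₀≋
      ; (suc i) → let j , eq = z∈P i in suc j , eq
      }

  -- A `Pair` lists its indices in increasing order, so which of two given points comes first is not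
  -- under control.
  Joins : ∀ {d} → Point d → Point d → Point d → Point d → Set
  Joins x y u v = (u ≋ x × v ≋ y) ⊎ (u ≋ y × v ≋ x)

  abstract

    joiningPair : ∀ {d n} (P : PointSet d n) {x y} → ⟦ P ⟧ x → ⟦ P ⟧ y → ¬ (x ≋ y) →
                  Σ (Pair n) λ ((i , j) , _) → Joins x y (Injection.to P i) (Injection.to P j)
    joiningPair P (i , x≋) (j , y≋) x≉y with Fin.<-cmp i j
    ... | tri< i<j _ _    = ((i , j) , i<j) , inj₁ (≋-sym x≋ , ≋-sym y≋)
    ... | tri≈ _ ≡.refl _ = ⊥-elim (x≉y (≋-trans x≋ (≋-sym y≋)))
    ... | tri> _ _ j<i    = ((j , i) , j<i) , inj₂ (≋-sym y≋ , ≋-sym x≋)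

-- Spheres of strictly convex norms are convexly independent.

module Norms (lem : ExcludedMiddle 0ℓ) (R : CompleteOrderedField) where

  open CompleteOrderedField R hiding (zero)
  open Geometry R
  open OrderedField lem R
  open InnerProduct lem R
  open PointSets lem R
  open RingSolver commutativeRing
  open ≤-Reasoning

  sum-mono-≤ : ∀ {k} {u v : Fin k → ℝ} → (∀ i → u i ≤ v i) → sum u ≤ sum v
  sum-mono-≤ {ℕ.zero}  u≤v = ≤-refl
  sum-mono-≤ {ℕ.suc k} u≤v = +-mono-≤ (u≤v zero) (sum-mono-≤ (u≤v ∘ suc))

  -- The average is at most the largest of the finitely many values, which is itself below `b`; this
  -- gives strictness without locating a positive weight.
  average< : ∀ {k} {w c : Fin k → ℝ} {b} → (∀ i → 0# ≤ w i) → sum w ≈ 1# → (∀ i → c i < b) →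
             sum (λ i → w i * c i) < b
  average< {ℕ.zero}              0≤w Σw≈1 c<b = ⊥-elim (0≉1 Σw≈1)
  average< {ℕ.suc k} {w} {c} {b} 0≤w Σw≈1 c<b with argmax c
  ... | i , c≤ci = ≤-<-trans (begin
    sum (λ j → w j * c j)  ≤⟨ sum-mono-≤ (λ j → *-monoˡ-≤-nonNeg (0≤w j) (c≤ci j)) ⟩
    sum (λ j → w j * c i)  ≈⟨ sum-cong-≋ (λ j → *-comm (w j) (c i)) ⟩
    sum (λ j → c i * w j)  ≈⟨ *-distribˡ-sum (c i) w ⟨
    c i * sum w            ≈⟨ trans (*-congˡ Σw≈1) (*-identityʳ (c i)) ⟩
    c i                    ∎) (c<b i)

  ∣x∣≈x : ∀ {x} → 0# ≤ x → ∣ x ∣ ≈ x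
  ∣x∣≈x {x} 0≤x = square-injective (∣x∣-nonNeg x) 0≤x (∣x∣*∣x∣≈x*x x)

  module _ {d} (N : Norm d) where
    open Norm N renaming (cong to ‖‖-cong)

    ‖·‖ : ∀ {a x} → 0# ≤ a → ‖ a · x ‖ ≈ a * ‖ x ‖
    ‖·‖ {a} {x} 0≤a = trans (homogeneous a x) (*-congʳ (∣x∣≈x 0≤a))

    ‖0‖≈0 : ‖ 0ᵥ ‖ ≈ 0#
    ‖0‖≈0 = begin-equality
      ‖ 0ᵥ ‖         ≈⟨ ‖‖-cong (λ j → zeroˡ 0#) ⟨
      ‖ 0# · 0ᵥ ‖    ≈⟨ ‖·‖ ≤-refl ⟩
      0# * ‖ 0ᵥ ‖    ≈⟨ zeroˡ _ ⟩
      0#             ∎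

    ‖linearCombination‖≤ : ∀ {k} {w : Fin k → ℝ} (p : Fin k → Point d) → (∀ i → 0# ≤ w i) →
                           ‖ linearCombination w p ‖ ≤ sum (λ i → w i * ‖ p i ‖)
    ‖linearCombination‖≤ {ℕ.zero}      p 0≤w = ≤-reflexive ‖0‖≈0
    ‖linearCombination‖≤ {ℕ.suc k} {w} p 0≤w = begin
      ‖ linearCombination w p ‖
        ≤⟨ triangle (w zero · p zero) (linearCombination (w ∘ suc) (p ∘ suc)) ⟩
      ‖ w zero · p zero ‖ + ‖ linearCombination (w ∘ suc) (p ∘ suc) ‖
        ≤⟨ +-mono-≤ (≤-reflexive (‖·‖ (0≤w zero))) (‖linearCombination‖≤ (p ∘ suc) (0≤w ∘ suc)) ⟩
      w zero * ‖ p zero ‖ + sum (λ i → w (suc i) * ‖ p (suc i) ‖)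
        ∎

    segment≤1 : ∀ {x y t} → ‖ x ‖ ≈ 1# → ‖ y ‖ ≈ 1# → 0# ≤ t → t ≤ 1# →
                ‖ (1# - t) · x +ᵥ t · y ‖ ≤ 1#
    segment≤1 {x} {y} {t} ‖x‖≈1 ‖y‖≈1 0≤t t≤1 = begin
      ‖ (1# - t) · x +ᵥ t · y ‖        ≤⟨ triangle _ _ ⟩
      ‖ (1# - t) · x ‖ + ‖ t · y ‖     ≈⟨ +-cong (‖·‖ (x≤y⇒0≤y-x t≤1)) (‖·‖ 0≤t) ⟩
      (1# - t) * ‖ x ‖ + t * ‖ y ‖     ≈⟨ +-cong (*-congˡ ‖x‖≈1) (*-congˡ ‖y‖≈1) ⟩
      (1# - t) * 1# + t * 1#           ≈⟨ solve 1 (λ t → (:1 :- t) :* :1 :+ t :* :1 := :1) refl t ⟩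
      1#                               ∎

    -- With a = t or 1 - t, a multiple of x + y splits into the point z of the
    -- segment and a multiple of its farther end e.
    chord≤ : ∀ {x y z e a} → ‖ e ‖ ≈ 1# → 1# + 1# ≤ ‖ x +ᵥ y ‖ → 0# ≤ a → 0# ≤ a + a - 1# →
             a · (x +ᵥ y) ≋ z +ᵥ (a + a - 1#) · e → 1# ≤ ‖ z ‖
    chord≤ {x} {y} {z} {e} {a} ‖e‖≈1 2≤ 0≤a 0≤2a-1 eq = 0≤y-x⇒x≤y (≤-respʳ
      (solve 2 (λ a z → z :+ (a :+ a :- :1) :* :1 :- a :* (:1 :+ :1) := z :- :1) refl a ‖ z ‖)
      (x≤y⇒0≤y-x (begin
        a * (1# + 1#)                    ≤⟨ *-monoˡ-≤-nonNeg 0≤a 2≤ ⟩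
        a * ‖ x +ᵥ y ‖                   ≈⟨ ‖·‖ 0≤a ⟨
        ‖ a · (x +ᵥ y) ‖                 ≈⟨ ‖‖-cong eq ⟩
        ‖ z +ᵥ (a + a - 1#) · e ‖        ≤⟨ triangle _ _ ⟩
        ‖ z ‖ + ‖ (a + a - 1#) · e ‖     ≈⟨ +-congˡ (trans (‖·‖ 0≤2a-1) (*-congˡ ‖e‖≈1)) ⟩
        ‖ z ‖ + (a + a - 1#) * 1#        ∎)))

    -- If the sum had norm at least 2, the whole segment between the points would lie on the sphere:
    -- `segment≤1` bounds its norms from above and `chord≤` from below.
    ‖x+y‖<2 : StrictlyConvex N → ∀ {x y} → ‖ x ‖ ≈ 1# → ‖ y ‖ ≈ 1# → ¬ (x ≋ y) → ‖ x +ᵥ y ‖ < 1# + 1#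
    ‖x+y‖<2 rotund {x} {y} ‖x‖≈1 ‖y‖≈1 x≉y = ≰⇒> λ 2≤‖x+y‖ → rotund x≉y λ t 0≤t t≤1 →
      ≤-antisym (segment≤1 ‖x‖≈1 ‖y‖≈1 0≤t t≤1) (1≤ 2≤‖x+y‖ t 0≤t t≤1 (total 0# (t + t - 1#)))
      where
      1≤ : 1# + 1# ≤ ‖ x +ᵥ y ‖ → ∀ t → 0# ≤ t → t ≤ 1# →
           0# ≤ t + t - 1# ⊎ t + t - 1# ≤ 0# → 1# ≤ ‖ (1# - t) · x +ᵥ t · y ‖
      1≤ 2≤ t 0≤t t≤1 (inj₁ 0≤2t-1) = chord≤ ‖x‖≈1 2≤ 0≤t 0≤2t-1 λ j →
        solve 3 (λ t x y → t :* (x :+ y) := ((:1 :- t) :* x :+ t :* y) :+ (t :+ t :- :1) :* x)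
          refl t (x j) (y j)
      1≤ 2≤ t 0≤t t≤1 (inj₂ 2t-1≤0) = chord≤ ‖y‖≈1 2≤ (x≤y⇒0≤y-x t≤1)
        (≤-respʳ (solve 1 (λ t → :- (t :+ t :- :1) := (:1 :- t) :+ (:1 :- t) :- :1) refl t)
          (x≤0⇒0≤-x 2t-1≤0)) λ j →
        solve 3 (λ t x y → (:1 :- t) :* (x :+ y) :=
                   ((:1 :- t) :* x :+ t :* y) :+ ((:1 :- t) :+ (:1 :- t) :- :1) :* y)
          refl t (x j) (y j)

    -- If x = Σ wᵢ yᵢ then 2x = Σ wᵢ (x + yᵢ), whose norm is less than 2.
    sphere-convexlyIndependent : StrictlyConvex N → ∀ {S : Pred (Point d) 0ℓ} →
      (∀ {x} → S x → ‖ x ‖ ≈ 1#) → ConvexlyIndependent S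
    sphere-convexlyIndependent rotund {S} S⊆sphere {x} Sx (k , w , p , 0≤w , Σw≈1 , p∈S , x≋) =
      <⇒≱ (average< 0≤w Σw≈1 λ i → ‖x+y‖<2 rotund (S⊆sphere Sx) (S⊆sphere (proj₁ (p∈S i)))
             (proj₂ (p∈S i) ∘ ≋-sym)) (begin
        1# + 1#                                   ≈⟨ trans (*-congˡ (S⊆sphere Sx)) (*-identityʳ _) ⟨
        (1# + 1#) * ‖ x ‖                         ≈⟨ ‖·‖ (<⇒≤ 0<2) ⟨
        ‖ (1# + 1#) · x ‖                         ≈⟨ ‖‖-cong 2x≋ ⟩
        ‖ linearCombination w (λ i → x +ᵥ p i) ‖  ≤⟨ ‖linearCombination‖≤ _ 0≤w ⟩
        sum (λ i → w i * ‖ x +ᵥ p i ‖)            ∎)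
      where
      2x≋ : (1# + 1#) · x ≋ linearCombination w (λ i → x +ᵥ p i)
      2x≋ j = begin-equality
        (1# + 1#) * x j
          ≈⟨ solve 1 (λ x → (:1 :+ :1) :* x := x :* :1 :+ x) refl (x j) ⟩
        x j * 1# + x j                        ≈⟨ +-cong (*-congˡ (sym Σw≈1)) (x≋ j) ⟩
        x j * sum w + sum (λ i → w i * p i j) ≈⟨ +-congʳ (*-distribˡ-sum (x j) w) ⟩
        sum (λ i → x j * w i) + sum (λ i → w i * p i j)
                                              ≈⟨ ∑-distrib-+ (λ i → x j * w i) (λ i → w i * p i j) ⟨
        sum (λ i → x j * w i + w i * p i j)   ≈⟨ sum-cong-≋ (λ i →
                                                   solve 3 (λ x w p → x :* w :+ w :* p := w :* (x :+ p)) refl (x j) (w i) (p i j)) ⟩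
        sum (λ i → w i * (x j + p i j))       ∎

-- `E` and `W` are at most `M`.

module UpperBounds (lem : ExcludedMiddle 0ℓ) (R : CompleteOrderedField) where

  open CompleteOrderedField R hiding (zero)
  open Geometry R
  open Maximum lem
  open Extremal lem R
  open OrderedField lem R
  open Norms lem R
  open PointSets lem R
  open RingSolver commutativeRing
  open ≤-Reasoning

  scaleSet : ∀ {d n a} → a ≉ 0# → PointSet d n → PointSet d n
  scaleSet {a = a} a≉0 P = pointSet (λ i → a · Injection.to P i) λ eq →
    Injection.injective P λ j → *-cancelˡ-≈ a≉0 (eq j)

  midpoints⇒sum : ∀ {d n k} {P : PointSet d n} → ConvexMidpoints P k → ConvexSubsetOfSum d n n k
  midpoints⇒sum {P = P} (e , inj , indep) = ½P , ½P , pointSet _ inj , ⊆½P⊕½P , indep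
    where
    ½P : PointSet _ _
    ½P = scaleSet (proj₂ 0<½ ∘ sym) P
    ⊆½P⊕½P : ∀ {x} → ⟦ pointSet _ inj ⟧ x → (⟦ ½P ⟧ ⊕ ⟦ ½P ⟧) x
    ⊆½P⊕½P (a , x≋) = let (i , j) , _ = Injection.to e a in
      _ , _ , (i , ≋-refl) , (j , ≋-refl) , λ l → trans (x≋ l) (distribˡ _ _ _)

  segments⇒sum : ∀ {d n k} → NonparallelUnitSegments d n k → ConvexSubsetOfSum d n n k
  segments⇒sum {d} {n} {k} (P , N , rotund , e , unit , nonpar) =
    P , -P , pointSet dir inj , ⊆P⊕-P ,
    sphere-convexlyIndependent N rotund λ (a , x≋) → trans (Norm.cong N x≋) (unit a)
    where
    dir : Fin k → Point d
    dir = onPair _-ᵥ_ P ∘ Injection.to e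
    -P : PointSet d n
    -P = pointSet (λ i l → - Injection.to P i l) λ {i} {j} eq → Injection.injective P λ l → begin-equality
      Injection.to P i l        ≈⟨ solve 1 (λ x → x := :- (:- x)) refl _ ⟩
      - - Injection.to P i l    ≈⟨ -‿cong (eq l) ⟩
      - - Injection.to P j l    ≈⟨ solve 1 (λ x → :- (:- x) := x) refl _ ⟩
      Injection.to P j l        ∎
    inj : ∀ {a b} → dir a ≋ dir b → a ≡ b
    inj {a} {b} eq with a Fin.≟ b
    ... | yes a≡b = a≡b
    ... | no  a≢b = ⊥-elim (nonpar a≢b (1# , λ l → trans (eq l) (sym (*-identityˡ _))))
    ⊆P⊕-P : ∀ {x} → ⟦ pointSet dir inj ⟧ x → (⟦ P ⟧ ⊕ ⟦ -P ⟧) x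
    ⊆P⊕-P (a , x≋) = let (i , j) , _ = Injection.to e a in
      _ , _ , (i , ≋-refl) , (j , ≋-refl) , x≋

  -- A maximum is attained or is the conventional value 0 of an empty set. With this alternative,
  -- bounding `max` from above does not call for a configuration.
  max≡0⊎attained : ∀ {S : Pred ℕ 0ℓ} (bdd : Bounded S) → max S bdd ≡ 0 ⊎ S (max S bdd)
  max≡0⊎attained {S} (b , _) = go b
    where
    go : ∀ b → greatestUpTo S b ≡ 0 ⊎ S (greatestUpTo S b)
    go ℕ.zero    = inj₁ ≡.refl
    go (ℕ.suc b) with lem {S (ℕ.suc b)}
    ... | yes Sb = inj₂ Sb
    ... | no  _  = go b

  max≤ : ∀ {S : Pred ℕ 0ℓ} (bdd : Bounded S) {m} → (∀ {k} → S k → k ℕ.≤ m) → max S bdd ℕ.≤ m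
  max≤ bdd S≤m with max≡0⊎attained bdd
  ... | inj₁ ≡0 = ℕ.≤-trans (ℕ.≤-reflexive ≡0) ℕ.z≤n
  ... | inj₂ Sm = S≤m Sm

  sum≤M : ∀ {d m n k} → ConvexSubsetOfSum d m n k → k ℕ.≤ M d m n
  sum≤M {d} {m} {n} = max-upper (m ℕ.* n , convexSubsetOfSum-bound)

  E-bounded : ∀ d n → Bounded (λ k → ∃ λ (P : PointSet d n) → E-of P ≡ k)
  E-bounded d n = n ℕ.* n , λ { (P , ≡.refl) → E-of-bound P }

  W-bounded : ∀ d n → Bounded (NonparallelUnitSegments d n)
  W-bounded d n = n ℕ.* n , λ (_ , _ , _ , e , _) → pairs-bound e

  E≤M : ∀ d n → E d n ℕ.≤ M d n n
  E≤M d n = max≤ (E-bounded d n) λ { (P , ≡.refl) →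
    max≤ (midpoints-bounded P) λ {k} → sum≤M {d} {n} {n} {k} ∘ midpoints⇒sum {P = P} }

  W≤M : ∀ d n → W d n ℕ.≤ M d n n
  W≤M d n = max≤ (W-bounded d n) λ {k} → sum≤M {d} {n} {n} {k} ∘ segments⇒sum

-- Strictly convex norms whose unit balls are intersections of ellipsoids.

module QuadraticNorms (lem : ExcludedMiddle 0ℓ) (R : CompleteOrderedField) where

  open CompleteOrderedField R hiding (zero)
  open Geometry R
  open OrderedField lem R
  open InnerProduct lem R
  open PointSets lem R
  open RingSolver commutativeRing
  open ≤-Reasoning

  -- The squares of Euclidean norms, with `q-mix` in place of a bilinear form: it yields both the
  -- triangle inequality and strict convexity for maxima of such forms.
  record QuadraticForm (d : ℕ) : Set where
    field
      q           : Point d → ℝ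
      q-cong      : ∀ {x y} → x ≋ y → q x ≈ q y
      q-nonNeg    : ∀ x → 0# ≤ q x
      q-definite  : ∀ {x} → q x ≤ 0# → x ≋ 0ᵥ
      q-·         : ∀ a x → q (a · x) ≈ a * a * q x
      -- The identity q ((1 - t) u + t v) + t (1 - t) q (u - v) = (1 - t) q u + t q v
      -- at u = x / l, v = y / m and t = m / (l + m), cleared of denominators.
      q-mix       : ∀ l m x y →
                    l * m * q (x +ᵥ y) + q (m · x -ᵥ l · y) ≈ (l + m) * (m * q x + l * q y)

  open QuadraticForm

  -- Raising `t` flattens the unit ball in the direction of `f`, and `c` sets its size. The
  -- Euclidean term keeps the form definite for every `t`.
  ellipsoid : ∀ {d} (f : Point d) {c t} → 0# < c → 0# ≤ t → QuadraticForm d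
  ellipsoid {d} f {c} {t} 0<c 0≤t = record
    { q          = form
    ; q-cong     = λ x≋y → *-congˡ (+-cong (∙∙-cong x≋y) (*-congˡ (*-cong (∙-congˡ f x≋y) (∙-congˡ f x≋y))))
    ; q-nonNeg   = λ x → *-nonNeg (<⇒≤ 0<c) (inner-nonNeg x)
    ; q-definite = λ {x} qx≤0 → x∙x≤0⇒x≋0 (≤-trans (inner-≥ x)
        (*-cancelˡ-≤-pos 0<c (≤-respʳ (sym (zeroʳ c)) qx≤0)))
    ; q-·        = λ a x → trans
        (*-congˡ (+-cong (trans (∙-homo-· (a · x) a x) (*-congˡ (trans (∙-comm (a · x) x) (∙-homo-· x a x))))
                        (*-congˡ (*-cong (∙-homo-· f a x) (∙-homo-· f a x)))))
        (solve 5 (λ a c t X F → c :* (a :* (a :* X) :+ t :* ((a :* F) :* (a :* F))) :=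
                                a :* a :* (c :* (X :+ t :* (F :* F)))) refl a c t (x ∙ x) (f ∙ x))
    ; q-mix      = λ l m x y → combine (∙∙-mix l m x y) (f²-mix l m x y)
    }
    where
    form : Point d → ℝ
    form x = c * (x ∙ x + t * ((f ∙ x) * (f ∙ x)))

    ∙∙-cong : ∀ {x y : Point d} → x ≋ y → x ∙ x ≈ y ∙ y
    ∙∙-cong x≋y = sum-cong-≋ λ j → *-cong (x≋y j) (x≋y j)

    inner-≥ : ∀ x → x ∙ x ≤ x ∙ x + t * ((f ∙ x) * (f ∙ x))
    inner-≥ x = ≤-respˡ (+-identityʳ _) (+-monoʳ-≤ _ (*-nonNeg 0≤t (square-nonNeg (f ∙ x))))

    inner-nonNeg : ∀ x → 0# ≤ x ∙ x + t * ((f ∙ x) * (f ∙ x))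
    inner-nonNeg x = ≤-trans (x∙x-nonNeg x) (inner-≥ x)

    ∙∙-mix : ∀ l m (x y : Point d) → l * m * ((x +ᵥ y) ∙ (x +ᵥ y)) + (m · x -ᵥ l · y) ∙ (m · x -ᵥ l · y)
                                   ≈ (l + m) * (m * (x ∙ x) + l * (y ∙ y))
    ∙∙-mix l m x y = begin-equality
      l * m * ((x +ᵥ y) ∙ (x +ᵥ y)) + (m · x -ᵥ l · y) ∙ (m · x -ᵥ l · y)
        ≈⟨ +-congʳ (*-distribˡ-sum (l * m) (λ j → (x j + y j) * (x j + y j))) ⟩
      sum (λ j → l * m * ((x j + y j) * (x j + y j))) + (m · x -ᵥ l · y) ∙ (m · x -ᵥ l · y)
        ≈⟨ ∑-distrib-+ (λ j → l * m * ((x j + y j) * (x j + y j)))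
                       (λ j → (m * x j - l * y j) * (m * x j - l * y j)) ⟨
      sum (λ j → l * m * ((x j + y j) * (x j + y j)) + (m * x j - l * y j) * (m * x j - l * y j))
        ≈⟨ sum-cong-≋ (λ j → solve 4 (λ l m x y →
             l :* m :* ((x :+ y) :* (x :+ y)) :+ (m :* x :- l :* y) :* (m :* x :- l :* y) :=
             (l :+ m) :* (m :* (x :* x) :+ l :* (y :* y))) refl l m (x j) (y j)) ⟩
      sum (λ j → (l + m) * (m * (x j * x j) + l * (y j * y j)))
        ≈⟨ *-distribˡ-sum (l + m) (λ j → m * (x j * x j) + l * (y j * y j)) ⟨
      (l + m) * sum (λ j → m * (x j * x j) + l * (y j * y j))
        ≈⟨ *-congˡ (∑-distrib-+ (λ j → m * (x j * x j)) (λ j → l * (y j * y j))) ⟩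
      (l + m) * (sum (λ j → m * (x j * x j)) + sum (λ j → l * (y j * y j)))
        ≈⟨ *-congˡ (+-cong (*-distribˡ-sum m (λ j → x j * x j)) (*-distribˡ-sum l (λ j → y j * y j))) ⟨
      (l + m) * (m * (x ∙ x) + l * (y ∙ y))
        ∎

    f-mix : ∀ l m x y → f ∙ (m · x -ᵥ l · y) ≈ m * (f ∙ x) - l * (f ∙ y)
    f-mix l m x y = trans (∙-distribˡ--ᵥ f _ _) (+-cong (∙-homo-· f m x) (-‿cong (∙-homo-· f l y)))

    f²-mix : ∀ l m x y →
             l * m * ((f ∙ (x +ᵥ y)) * (f ∙ (x +ᵥ y))) + (f ∙ (m · x -ᵥ l · y)) * (f ∙ (m · x -ᵥ l · y))
             ≈ (l + m) * (m * ((f ∙ x) * (f ∙ x)) + l * ((f ∙ y) * (f ∙ y)))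
    f²-mix l m x y = trans
      (+-cong (*-congˡ (*-cong (∙-distribˡ-+ᵥ f x y) (∙-distribˡ-+ᵥ f x y))) (*-cong (f-mix l m x y) (f-mix l m x y)))
      (solve 4 (λ l m x y →
         l :* m :* ((x :+ y) :* (x :+ y)) :+ (m :* x :- l :* y) :* (m :* x :- l :* y) :=
         (l :+ m) :* (m :* (x :* x) :+ l :* (y :* y))) refl l m (f ∙ x) (f ∙ y))

    -- The identity `q-mix` is linear in the form, so it passes from the Euclidean square and the
    -- square of `f` to their combination.
    combine : ∀ {e s l m A₊ A₋ A₁ A₂ B₊ B₋ B₁ B₂} →
              e * A₊ + A₋ ≈ s * (m * A₁ + l * A₂) → e * B₊ + B₋ ≈ s * (m * B₁ + l * B₂) →
              e * (c * (A₊ + t * B₊)) + c * (A₋ + t * B₋) ≈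
              s * (m * (c * (A₁ + t * B₁)) + l * (c * (A₂ + t * B₂)))
    combine {e} {s} {l} {m} {A₊} {A₋} {A₁} {A₂} {B₊} {B₋} {B₁} {B₂} eqA eqB = begin-equality
      e * (c * (A₊ + t * B₊)) + c * (A₋ + t * B₋)
        ≈⟨ solve 7 (λ e c t A₊ A₋ B₊ B₋ →
             e :* (c :* (A₊ :+ t :* B₊)) :+ c :* (A₋ :+ t :* B₋) :=
             c :* ((e :* A₊ :+ A₋) :+ t :* (e :* B₊ :+ B₋))) refl e c t A₊ A₋ B₊ B₋ ⟩
      c * ((e * A₊ + A₋) + t * (e * B₊ + B₋))
        ≈⟨ *-congˡ (+-cong eqA (*-congˡ eqB)) ⟩
      c * (s * (m * A₁ + l * A₂) + t * (s * (m * B₁ + l * B₂)))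
        ≈⟨ solve 9 (λ s c t m l A₁ A₂ B₁ B₂ →
             c :* (s :* (m :* A₁ :+ l :* A₂) :+ t :* (s :* (m :* B₁ :+ l :* B₂))) :=
             s :* (m :* (c :* (A₁ :+ t :* B₁)) :+ l :* (c :* (A₂ :+ t :* B₂))))
             refl s c t m l A₁ A₂ B₁ B₂ ⟩
      s * (m * (c * (A₁ + t * B₁)) + l * (c * (A₂ + t * B₂)))
        ∎

  module MaximumNorm {d k} (Q : Fin (ℕ.suc k) → QuadraticForm d) where

    largest : Point d → QuadraticForm d
    largest x = Q (proj₁ (argmax λ a → q (Q a) x))

    q-largest : ∀ x a → q (Q a) x ≤ q (largest x) x
    q-largest x = proj₂ (argmax λ a → q (Q a) x)

    root : ∀ x → ∃ λ r → 0# ≤ r × r * r ≈ q (largest x) x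
    root x = sqrt (q-nonNeg (largest x) x)

    ‖_‖ : Point d → ℝ
    ‖ x ‖ = proj₁ (root x)

    ‖‖-nonNeg : ∀ x → 0# ≤ ‖ x ‖
    ‖‖-nonNeg x = proj₁ (proj₂ (root x))

    ‖‖²≈largest : ∀ x → ‖ x ‖ * ‖ x ‖ ≈ q (largest x) x
    ‖‖²≈largest x = proj₂ (proj₂ (root x))

    q≤‖‖² : ∀ x a → q (Q a) x ≤ ‖ x ‖ * ‖ x ‖
    q≤‖‖² x a = ≤-respʳ (sym (‖‖²≈largest x)) (q-largest x a)

    ‖‖-intro : ∀ {x r} → 0# ≤ r → (∀ a → q (Q a) x ≤ r * r) → ‖ x ‖ ≤ r
    ‖‖-intro {x} 0≤r q≤rr = square-cancel-≤ 0≤r (≤-respˡ (sym (‖‖²≈largest x)) (q≤rr _))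

    -- Neither the choice of `largest` nor that of `root` is known to respect `≋`, so the equality
    -- is obtained from two inequalities.
    ‖‖-cong : ∀ {x y} → x ≋ y → ‖ x ‖ ≈ ‖ y ‖
    ‖‖-cong {x} {y} x≋y = ≤-antisym
      (‖‖-intro (‖‖-nonNeg y) λ a → ≤-respˡ (q-cong (Q a) (≋-sym x≋y)) (q≤‖‖² y a))
      (‖‖-intro (‖‖-nonNeg x) λ a → ≤-respˡ (q-cong (Q a) x≋y) (q≤‖‖² x a))

    definite : ∀ {x} → ‖ x ‖ ≈ 0# → x ≋ 0ᵥ
    definite {x} ‖x‖≈0 = q-definite (Q zero) (≤-respʳ (trans (*-congʳ ‖x‖≈0) (zeroˡ _)) (q≤‖‖² x zero))

    homogeneous : ∀ a x → ‖ a · x ‖ ≈ ∣ a ∣ * ‖ x ‖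
    homogeneous a x = square-injective (‖‖-nonNeg _) (*-nonNeg (∣x∣-nonNeg a) (‖‖-nonNeg x)) (begin-equality
      ‖ a · x ‖ * ‖ a · x ‖                    ≈⟨ ≤-antisym ≤a²‖x‖² a²‖x‖²≤ ⟩
      a * a * (‖ x ‖ * ‖ x ‖)                  ≈⟨ *-congʳ (∣x∣*∣x∣≈x*x a) ⟨
      ∣ a ∣ * ∣ a ∣ * (‖ x ‖ * ‖ x ‖)
        ≈⟨ solve 2 (λ a x → a :* a :* (x :* x) := (a :* x) :* (a :* x)) refl ∣ a ∣ ‖ x ‖ ⟩
      (∣ a ∣ * ‖ x ‖) * (∣ a ∣ * ‖ x ‖)        ∎)
      where
      ≤a²‖x‖² : ‖ a · x ‖ * ‖ a · x ‖ ≤ a * a * (‖ x ‖ * ‖ x ‖)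
      ≤a²‖x‖² = begin
        ‖ a · x ‖ * ‖ a · x ‖          ≈⟨ ‖‖²≈largest (a · x) ⟩
        q (largest (a · x)) (a · x)    ≈⟨ q-· (largest (a · x)) a x ⟩
        a * a * q (largest (a · x)) x  ≤⟨ *-monoˡ-≤-nonNeg (square-nonNeg a) (q≤‖‖² x _) ⟩
        a * a * (‖ x ‖ * ‖ x ‖)        ∎
      a²‖x‖²≤ : a * a * (‖ x ‖ * ‖ x ‖) ≤ ‖ a · x ‖ * ‖ a · x ‖
      a²‖x‖²≤ = begin
        a * a * (‖ x ‖ * ‖ x ‖)        ≈⟨ *-congˡ (‖‖²≈largest x) ⟩
        a * a * q (largest x) x        ≈⟨ q-· (largest x) a x ⟨
        q (largest x) (a · x)          ≤⟨ q≤‖‖² (a · x) _ ⟩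
        ‖ a · x ‖ * ‖ a · x ‖          ∎

    -- Taking `l` and `m` in `q-mix` to be the norms of `x` and `y` and dropping its second term
    -- bounds l m q(x + y) by l m (l + m)². Cancelling l m requires both norms to be nonzero, hence
    -- the two separate cases.
    triangle : ∀ x y → ‖ x +ᵥ y ‖ ≤ ‖ x ‖ + ‖ y ‖
    triangle x y with lem {‖ x ‖ ≈ 0#} | lem {‖ y ‖ ≈ 0#}
    ... | yes l≈0 | _ = begin
      ‖ x +ᵥ y ‖       ≈⟨ ‖‖-cong (λ j → trans (+-congʳ (definite l≈0 j)) (+-identityˡ _)) ⟩
      ‖ y ‖            ≈⟨ +-identityˡ _ ⟨
      0# + ‖ y ‖       ≈⟨ +-congʳ l≈0 ⟨
      ‖ x ‖ + ‖ y ‖    ∎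
    ... | no _ | yes m≈0 = begin
      ‖ x +ᵥ y ‖       ≈⟨ ‖‖-cong (λ j → trans (+-congˡ (definite m≈0 j)) (+-identityʳ _)) ⟩
      ‖ x ‖            ≈⟨ +-identityʳ _ ⟨
      ‖ x ‖ + 0#       ≈⟨ +-congˡ m≈0 ⟨
      ‖ x ‖ + ‖ y ‖    ∎
    ... | no l≉0 | no m≉0 = ‖‖-intro (+-nonNeg (‖‖-nonNeg x) (‖‖-nonNeg y)) λ a →
      *-cancelˡ-≤-pos (*-pos (‖‖-nonNeg x , l≉0 ∘ sym) (‖‖-nonNeg y , m≉0 ∘ sym)) (begin
        l * m * q (Q a) (x +ᵥ y)
          ≈⟨ +-identityʳ _ ⟨
        l * m * q (Q a) (x +ᵥ y) + 0#
          ≤⟨ +-monoʳ-≤ _ (q-nonNeg (Q a) _) ⟩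
        l * m * q (Q a) (x +ᵥ y) + q (Q a) (m · x -ᵥ l · y)
          ≈⟨ q-mix (Q a) l m x y ⟩
        (l + m) * (m * q (Q a) x + l * q (Q a) y)
          ≤⟨ *-monoˡ-≤-nonNeg (+-nonNeg (‖‖-nonNeg x) (‖‖-nonNeg y)) (+-mono-≤
               (*-monoˡ-≤-nonNeg (‖‖-nonNeg y) (q≤‖‖² x a)) (*-monoˡ-≤-nonNeg (‖‖-nonNeg x) (q≤‖‖² y a))) ⟩
        (l + m) * (m * (l * l) + l * (m * m))
          ≈⟨ solve 2 (λ l m → (l :+ m) :* (m :* (l :* l) :+ l :* (m :* m)) :=
                              l :* m :* ((l :+ m) :* (l :+ m))) refl l m ⟩
        l * m * ((l + m) * (l + m))
          ∎)
      where
      l = ‖ x ‖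
      m = ‖ y ‖

    norm : Norm d
    norm = record
      { ‖_‖ = ‖_‖ ; cong = ‖‖-cong ; nonNeg = ‖‖-nonNeg ; definite = definite
      ; homogeneous = homogeneous ; triangle = triangle }

    ‖‖≈1 : ∀ {x} a → q (Q a) x ≈ 1# → (∀ b → q (Q b) x ≤ 1#) → ‖ x ‖ ≈ 1#
    ‖‖≈1 {x} a qa≈1 q≤1 = ≤-antisym
      (‖‖-intro (<⇒≤ 0<1) λ b → ≤-respʳ (sym (*-identityˡ 1#)) (q≤1 b))
      (square-cancel-≤ (‖‖-nonNeg x) (≤-respˡ (trans qa≈1 (sym (*-identityˡ 1#))) (q≤‖‖² x a)))

    -- Let `G` be the form attaining the norm at the midpoint. By the parallelogram law, `G` at half
    -- of the difference is at most 1 - 1 = 0, so definiteness forces the two points to coincide.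
    ‖midpoint‖<1 : ∀ {x y} → ‖ x ‖ ≈ 1# → ‖ y ‖ ≈ 1# → ¬ (x ≋ y) → ¬ (‖ ½ · x +ᵥ ½ · y ‖ ≈ 1#)
    ‖midpoint‖<1 {x} {y} ‖x‖≈1 ‖y‖≈1 x≉y ‖z‖≈1 = x≉y λ j →
      *-cancelˡ-≈ (proj₂ 0<½ ∘ sym) (begin-equality
        ½ * x j
          ≈⟨ solve 2 (λ a b → a := (:1 :* a :- :1 :* b) :+ b) refl (½ * x j) (½ * y j) ⟩
        (1# * (½ * x j) - 1# * (½ * y j)) + ½ * y j
                                             ≈⟨ +-congʳ (q-definite G G-difference≤0 j) ⟩
        0# + ½ * y j                         ≈⟨ +-identityˡ _ ⟩
        ½ * y j                              ∎)
      where
      z : Point d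
      z = ½ · x +ᵥ ½ · y

      G : QuadraticForm d
      G = largest z

      Gz≈1 : q G z ≈ 1#
      Gz≈1 = trans (sym (‖‖²≈largest z)) (trans (*-cong ‖z‖≈1 ‖z‖≈1) (*-identityˡ 1#))

      G½≤ : ∀ {v} → ‖ v ‖ ≈ 1# → q G (½ · v) ≤ ½ * ½
      G½≤ {v} ‖v‖≈1 = begin
        q G (½ · v)                 ≈⟨ q-· G ½ v ⟩
        ½ * ½ * q G v               ≤⟨ *-monoˡ-≤-nonNeg (square-nonNeg ½) (q≤‖‖² v _) ⟩
        ½ * ½ * (‖ v ‖ * ‖ v ‖)     ≈⟨ *-congˡ (*-cong ‖v‖≈1 ‖v‖≈1) ⟩
        ½ * ½ * (1# * 1#)           ≈⟨ solve 1 (λ h → h :* (:1 :* :1) := h) refl (½ * ½) ⟩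
        ½ * ½                       ∎

      G-difference≤0 : q G (1# · (½ · x) -ᵥ 1# · (½ · y)) ≤ 0#
      G-difference≤0 = begin
        δ
          ≈⟨ solve 2 (λ z δ → δ := (:1 :* :1 :* z :+ δ) :- z) refl (q G z) δ ⟩
        (1# * 1# * q G z + δ) - q G z
          ≈⟨ +-cong (q-mix G 1# 1# (½ · x) (½ · y)) (-‿cong Gz≈1) ⟩
        (1# + 1#) * (1# * q G (½ · x) + 1# * q G (½ · y)) - 1#
          ≤⟨ +-mono-≤ (*-monoˡ-≤-nonNeg (<⇒≤ 0<2) (+-mono-≤
               (*-monoˡ-≤-nonNeg (<⇒≤ 0<1) (G½≤ ‖x‖≈1)) (*-monoˡ-≤-nonNeg (<⇒≤ 0<1) (G½≤ ‖y‖≈1)))) ≤-refl ⟩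
        (1# + 1#) * (1# * (½ * ½) + 1# * (½ * ½)) - 1#
          ≈⟨ solve 1 (λ h → (:1 :+ :1) :* (:1 :* (h :* h) :+ :1 :* (h :* h)) :- :1 :=
                            (h :+ h) :* (h :+ h) :- :1) refl ½ ⟩
        (½ + ½) * (½ + ½) - 1#
          ≈⟨ +-congʳ (trans (*-cong ½+½≈1 ½+½≈1) (*-identityˡ 1#)) ⟩
        1# - 1#                                    ≈⟨ -‿inverseʳ 1# ⟩
        0#                                         ∎
        where
        δ = q G (1# · (½ · x) -ᵥ 1# · (½ · y))

    strictlyConvex : StrictlyConvex norm
    strictlyConvex {x} {y} x≉y segment≈1 = ‖midpoint‖<1
      (trans (‖‖-cong λ j → solve 2 (λ x y → x := (:1 :- :0) :* x :+ :0 :* y) refl (x j) (y j))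
             (segment≈1 0# ≤-refl (<⇒≤ 0<1)))
      (trans (‖‖-cong λ j → solve 2 (λ x y → y := (:1 :- :1) :* x :+ :1 :* y) refl (x j) (y j))
             (segment≈1 1# (<⇒≤ 0<1) ≤-refl))
      x≉y
      (trans (‖‖-cong λ j → +-congʳ (*-congʳ (trans (solve 1 (λ h → h := (h :+ h) :- h) refl ½) (+-congʳ ½+½≈1))))
             (segment≈1 ½ (<⇒≤ 0<½) ½≤1))
      where
      ½≤1 : ½ ≤ 1#
      ½≤1 = ≤-respʳ ½+½≈1 (≤-respˡ (+-identityˡ ½) (+-mono-≤ (<⇒≤ 0<½) ≤-refl))

  NormWithUnitVectors : ∀ {d k} → (Fin k → Point d) → Set
  NormWithUnitVectors {d} s = Σ (Norm d) λ N → StrictlyConvex N × (∀ a → Norm.‖_‖ N (s a) ≈ 1#)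

  -- The a-th ellipsoid, elongated along the kernel of f a, passes through s a
  -- and contains the other points; the unit ball is the intersection of all of them.
  abstract

    unitNorm : ∀ {d k} (s f : Fin (ℕ.suc k) → Point d) → (∀ a → 0# < f a ∙ s a) →
      (∀ a b → b ≢ a → (f a ∙ s b) * (f a ∙ s b) < (f a ∙ s a) * (f a ∙ s a)) →
      NormWithUnitVectors s
    unitNorm {d} {k} s f 0<fs fsb<fsa = norm , strictlyConvex , λ a → ‖‖≈1 a (qa≈1 a) (λ b → q≤1 b a)
      where
      F : Fin (ℕ.suc k) → Fin (ℕ.suc k) → ℝ
      F a b = (f a ∙ s b) * (f a ∙ s b)

      -- Since the gap between `F a a` and the other values is positive, a large multiple of it
      -- outweighs any excess of Euclidean length, and no other point leaves the ellipsoid through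
      -- `s a`.
      stretch : ∀ a → ∃ λ t → 0# ≤ t × (∀ b → s (Fin.punchIn a b) ∙ s (Fin.punchIn a b) - s a ∙ s a
                                             ≤ t * (F a a - F a (Fin.punchIn a b)))
      stretch a = dominate _ _ λ b → x<y⇒0<y-x (fsb<fsa a (Fin.punchIn a b) (Fin.punchInᵢ≢i a b))

      t : Fin (ℕ.suc k) → ℝ
      t a = proj₁ (stretch a)

      level : Fin (ℕ.suc k) → Fin (ℕ.suc k) → ℝ
      level a b = s b ∙ s b + t a * F a b

      0<s∙s : ∀ a → 0# < s a ∙ s a
      0<s∙s a = x∙x-nonNeg (s a) , λ 0≈ → proj₂ (0<fs a) (sym (begin-equality
        f a ∙ s a    ≈⟨ ∙-congˡ (f a) (x∙x≤0⇒x≋0 (≤-reflexive (sym 0≈))) ⟩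
        f a ∙ 0ᵥ     ≈⟨ trans (∙-comm (f a) 0ᵥ) (0∙x≈0 (f a)) ⟩
        0#           ∎))

      0<level : ∀ a → 0# < level a a
      0<level a = +-pos-nonNeg (0<s∙s a) (*-nonNeg (proj₁ (proj₂ (stretch a))) (square-nonNeg _))

      level-punchIn≤ : ∀ a b → level a (Fin.punchIn a b) ≤ level a a
      level-punchIn≤ a b = 0≤y-x⇒x≤y (≤-respʳ
        (solve 5 (λ t A B x y → t :* (A :- B) :- (y :- x) := (x :+ t :* A) :- (y :+ t :* B))
           refl (t a) (F a a) (F a _) (s a ∙ s a) _)
        (x≤y⇒0≤y-x (proj₂ (proj₂ (stretch a)) b)))

      level≤ : ∀ a b → level a b ≤ level a a
      level≤ a b with b Fin.≟ a
      ... | yes ≡.refl = ≤-refl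
      ... | no  b≢a    = ≡.subst (λ c → level a c ≤ level a a)
        (Fin.punchIn-punchOut (b≢a ∘ ≡.sym)) (level-punchIn≤ a _)

      Q : Fin (ℕ.suc k) → QuadraticForm d
      Q a = ellipsoid (f a) (⁻¹-pos (0<level a)) (proj₁ (proj₂ (stretch a)))

      open MaximumNorm Q

      qa≈1 : ∀ a → q (Q a) (s a) ≈ 1#
      qa≈1 a = ⁻¹-inverseˡ (proj₂ (0<level a) ∘ sym)

      q≤1 : ∀ a b → q (Q a) (s b) ≤ 1#
      q≤1 a b = ≤-respʳ (qa≈1 a) (*-monoˡ-≤-nonNeg (<⇒≤ (⁻¹-pos (0<level a))) (level≤ a b))

-- `M` is at most a constant multiple of `E` and of `W`.

module LowerBounds (lem : ExcludedMiddle 0ℓ) (R : CompleteOrderedField) where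

  open CompleteOrderedField R hiding (zero)
  open Geometry R
  open Maximum lem
  open Extremal lem R
  open OrderedField lem R
  open InnerProduct lem R
  open Separation lem R
  open PointSets lem R
  open QuadraticNorms lem R
  open UpperBounds lem R
  open RingSolver commutativeRing
  open ≤-Reasoning

  independent-∘ : ∀ {d k k′} {s : Fin k → Point d} (ι : Fin k′ → Fin k) → (∀ {a b} → ι a ≡ ι b → a ≡ b) →
                  ConvexlyIndependentFamily s → ConvexlyIndependentFamily (s ∘ ι)
  independent-∘ ι ι-inj (s-inj , indep) = ι-inj ∘ s-inj , λ { (a , x≋) (k , w , p , 0≤w , Σw≈1 , p∈ , eq) →
    indep (ι a , x≋) (k , w , p , 0≤w , Σw≈1 , (λ i → let (b , p≋) , p≉x = p∈ i in (ι b , p≋) , p≉x) , eq) }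

  Range-cong : ∀ {d k} {s s′ : Fin k → Point d} → (∀ a → s a ≋ s′ a) → ∀ {x} → Range s x → Range s′ x
  Range-cong s≋s′ (a , x≋) = a , ≋-trans x≋ (s≋s′ a)

  independent-cong : ∀ {d k} {s s′ : Fin k → Point d} → (∀ a → s a ≋ s′ a) →
                     ConvexlyIndependentFamily s → ConvexlyIndependentFamily s′
  independent-cong {s = s} {s′} s≋s′ (s-inj , indep) =
    (λ {a} {b} eq → s-inj (≋-trans (s≋s′ a) (≋-trans eq (≋-sym (s≋s′ b))))) ,
    λ Sx (k , w , p , 0≤w , Σw≈1 , p∈ , eq) → indep (back Sx)
      (k , w , p , 0≤w , Σw≈1 , (λ i → back (proj₁ (p∈ i)) , proj₂ (p∈ i)) , eq)
    where
    back : ∀ {x} → Range s′ x → Range s x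
    back = Range-cong λ a → ≋-sym (s≋s′ a)

  -- The summands are families rather than point sets because blocks may repeat a point; `cover`
  -- restores a point set of full size later.
  record Sums (d h h′ k : ℕ) : Set where
    field
      p : Fin h → Point d
      q : Fin h′ → Point d
      α : Fin k → Fin h
      β : Fin k → Fin h′

    s : Fin k → Point d
    s a = p (α a) +ᵥ q (β a)

  -- P and Q are covered by three blocks each, and one of the nine pairs of blocks
  -- carries at least a ninth of the sums.
  restrictToBlocks : ∀ {d n h h′ k} → Fin n → n ℕ.≤ 3 ℕ.* h → n ℕ.≤ 3 ℕ.* h′ →
    ConvexSubsetOfSum d n n k →
    ∃ λ k′ → Σ (Sums d h h′ k′) λ F → ConvexlyIndependentFamily (Sums.s F) × k ℕ.≤ 9 ℕ.* k′
  restrictToBlocks {d} {n} {h} {h′} {k} i₀ n≤3h n≤3h′ (P , Q , S , S⊆P⊕Q , indep) =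
    let c , k′ , selection , k≤9k′ = hole in k′ , family c selection , family-independent c selection , k≤9k′
    where
    coverP : Σ (Fin 3 → Fin h → Fin n) λ b → ∀ i → ∃₂ λ c x → b c x ≡ i
    coverP = blocks i₀ n≤3h

    coverQ : Σ (Fin 3 → Fin h′ → Fin n) λ b → ∀ i → ∃₂ λ c x → b c x ≡ i
    coverQ = blocks i₀ n≤3h′

    i : Fin k → Fin n
    i a = let _ , _ , (i , _) , _ = S⊆P⊕Q (a , ≋-refl) in i

    j : Fin k → Fin n
    j a = let _ , _ , _ , (j , _) , _ = S⊆P⊕Q (a , ≋-refl) in j

    S≋ : ∀ a → Injection.to S a ≋ Injection.to P (i a) +ᵥ Injection.to Q (j a)
    S≋ a = let _ , _ , (_ , p≋) , (_ , q≋) , s≋ = S⊆P⊕Q (a , ≋-refl)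
           in ≋-trans s≋ λ l → +-cong (p≋ l) (q≋ l)

    colour : Fin k → Fin 9
    colour a = Fin.combine (proj₁ (proj₂ coverP (i a))) (proj₁ (proj₂ coverQ (j a)))

    hole : ∃₂ λ c k′ → Selection (λ a → colour a ≡ c) k′ × k ℕ.≤ 9 ℕ.* k′
    hole = pigeonhole colour

    family : ∀ c {k′} → Selection (λ a → colour a ≡ c) k′ → Sums d h h′ k′
    family c (ι , _) = record
      { p = Injection.to P ∘ proj₁ coverP (proj₁ (Fin.remQuot {3} 3 c))
      ; q = Injection.to Q ∘ proj₁ coverQ (proj₂ (Fin.remQuot {3} 3 c))
      ; α = λ a → proj₁ (proj₂ (proj₂ coverP (i (ι a))))
      ; β = λ a → proj₁ (proj₂ (proj₂ coverQ (j (ι a))))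
      }

    family-independent : ∀ c {k′} (selection : Selection (λ a → colour a ≡ c) k′) →
                         ConvexlyIndependentFamily (Sums.s (family c selection))
    family-independent c (ι , ι-inj , colour≡c) =
      independent-cong eq (independent-∘ ι ι-inj (Injection.injective S , indep))
      where
      split≡ : ∀ a → Fin.remQuot {3} 3 c ≡ (proj₁ (proj₂ coverP (i (ι a))) , proj₁ (proj₂ coverQ (j (ι a))))
      split≡ a = ≡.trans (≡.cong (Fin.remQuot {3} 3) (≡.sym (colour≡c a))) (Fin.remQuot-combine {3} {3} _ _)

      i≡ : ∀ a → proj₁ coverP (proj₁ (Fin.remQuot {3} 3 c)) (proj₁ (proj₂ (proj₂ coverP (i (ι a))))) ≡ i (ι a)
      i≡ a = ≡.trans (≡.cong (λ z → proj₁ coverP (proj₁ z) _) (split≡ a)) (proj₂ (proj₂ (proj₂ coverP (i (ι a)))))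

      j≡ : ∀ a → proj₁ coverQ (proj₂ (Fin.remQuot {3} 3 c)) (proj₁ (proj₂ (proj₂ coverQ (j (ι a))))) ≡ j (ι a)
      j≡ a = ≡.trans (≡.cong (λ z → proj₁ coverQ (proj₂ z) _) (split≡ a)) (proj₂ (proj₂ (proj₂ coverQ (j (ι a)))))

      eq : ∀ a → Injection.to S (ι a) ≋ _
      eq a = ≋-trans (S≋ (ι a)) λ l → +-cong
        (reflexive (≡.cong (λ z → Injection.to P z l) (≡.sym (i≡ a))))
        (reflexive (≡.cong (λ z → Injection.to Q z l) (≡.sym (j≡ a))))

  module Construction {d h h′ k} (j₀ : Fin d) (F : Sums d h h′ k) where

    open Sums F

    -- Common to midpoints and segments: both families are placed in one set of `h + h′` points,
    -- where each sum determines a pair. The two ends must differ because a `Pair` has distinct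
    -- indices.
    module Pairs (u : Fin h → Point d) (v : Fin h′ → Point d) (u≉v : ∀ a → ¬ (u (α a) ≋ v (β a))) where

      covering : Σ (PointSet d (h ℕ.+ h′)) λ P → ∀ i → ⟦ P ⟧ ((u Vector.++ v) i)
      covering = cover j₀ (u Vector.++ v)

      points : PointSet d (h ℕ.+ h′)
      points = proj₁ covering

      u∈points : ∀ x → ⟦ points ⟧ (u x)
      u∈points x with proj₂ covering (x Fin.↑ˡ h′)
      ... | i , eq rewrite Fin.splitAt-↑ˡ h x h′ = i , eq

      v∈points : ∀ y → ⟦ points ⟧ (v y)
      v∈points y with proj₂ covering (h Fin.↑ʳ y)
      ... | i , eq rewrite Fin.splitAt-↑ʳ h h′ y = i , eq

      joined : ∀ a → Σ (Pair (h ℕ.+ h′)) λ ((i , j) , _) →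
               Joins (u (α a)) (v (β a)) (Injection.to points i) (Injection.to points j)
      joined a = joiningPair points (u∈points (α a)) (v∈points (β a)) (u≉v a)

      pair : Fin k → Pair (h ℕ.+ h′)
      pair = proj₁ ∘ joined

    midpoints : ConvexlyIndependentFamily s → ∃ λ (P : PointSet d (h ℕ.+ h′)) → ConvexMidpoints P k
    midpoints independent = points , mk↣ {to = pair} pair-inj , mid-inj , proj₂ mid-indep
      where
      -- The points 2p + v and 2q - v coincide exactly when v = q - p, so only finitely many values
      -- have to be avoided.
      shift : ∃ λ v → ∀ a → ¬ (v ≋ q (β a) -ᵥ p (α a))
      shift = fresh j₀ (λ a → q (β a) -ᵥ p (α a))

      v : Point d
      v = proj₁ shift

      -- These have p + q as midpoint, and v keeps them apart.
      u : Fin h → Point d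
      u x l = (p x l + p x l) + v l

      w : Fin h′ → Point d
      w y l = (q y l + q y l) - v l

      u≉w : ∀ a → ¬ (u (α a) ≋ w (β a))
      u≉w a u≋w = proj₂ shift a λ l → *-cancelˡ-≈ (proj₂ 0<2 ∘ sym) (begin-equality
        (1# + 1#) * v l
          ≈⟨ solve 2 (λ v p → (:1 :+ :1) :* v := ((p :+ p) :+ v) :+ v :- (p :+ p)) refl (v l) (p (α a) l) ⟩
        u (α a) l + v l - (p (α a) l + p (α a) l)
          ≈⟨ +-congʳ (+-congʳ (u≋w l)) ⟩
        w (β a) l + v l - (p (α a) l + p (α a) l)
          ≈⟨ solve 3 (λ v p q → ((q :+ q) :- v) :+ v :- (p :+ p) := (:1 :+ :1) :* (q :- p))
               refl (v l) (p (α a) l) (q (β a) l) ⟩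
        (1# + 1#) * (q (β a) l - p (α a) l)
          ∎)

      open Pairs u w u≉w

      mid : Pair (h ℕ.+ h′) → Point d
      mid = onPair midpoint points

      half-sum : ∀ a l {x y} → x ≈ u (α a) l → y ≈ w (β a) l → ½ * (x + y) ≈ s a l
      half-sum a l {x} {y} x≈ y≈ = begin-equality
        ½ * (x + y)
          ≈⟨ *-congˡ (+-cong x≈ y≈) ⟩
        ½ * (u (α a) l + w (β a) l)
          ≈⟨ solve 4 (λ h p q v → h :* (((p :+ p) :+ v) :+ ((q :+ q) :- v)) := (h :+ h) :* (p :+ q))
               refl ½ (p (α a) l) (q (β a) l) (v l) ⟩
        (½ + ½) * s a l
          ≈⟨ trans (*-congʳ ½+½≈1) (*-identityˡ _) ⟩
        s a l
          ∎

      joins⇒midpoint : ∀ a {x y} → Joins (u (α a)) (w (β a)) x y → s a ≋ midpoint x y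
      joins⇒midpoint a (inj₁ (x≋ , y≋)) l = sym (half-sum a l (x≋ l) (y≋ l))
      joins⇒midpoint a (inj₂ (x≋ , y≋)) l = sym (trans (*-congˡ (+-comm _ _)) (half-sum a l (y≋ l) (x≋ l)))

      s≋mid : ∀ a → s a ≋ mid (pair a)
      s≋mid a = joins⇒midpoint a (proj₂ (joined a))

      mid-indep : ConvexlyIndependentFamily (mid ∘ pair)
      mid-indep = independent-cong s≋mid independent

      mid-inj : ∀ {a b} → mid (pair a) ≋ mid (pair b) → a ≡ b
      mid-inj = proj₁ mid-indep

      pair-inj : ∀ {a b} → pair a ≡ pair b → a ≡ b
      pair-inj eq = mid-inj λ l → reflexive (≡.cong (λ e → mid e l) eq)

    -- The norm is even, so it does not matter in which order a pair is listed.
    segments : NormWithUnitVectors s →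
               (f : Fin k → Point d) → (∀ a → 0# < f a ∙ s a) →
               (∀ a b → b ≢ a → (f a ∙ s b) * (f a ∙ s b) < (f a ∙ s a) * (f a ∙ s a)) →
               NonparallelUnitSegments d (h ℕ.+ h′) k
    segments (N , convex , unit-s) f 0<fs fsb<fsa =
      points , N , convex , mk↣ {to = pair} pair-inj , unit-dir , nonparallel
      where
      open Norm N renaming (cong to ‖‖-cong)

      -q : Fin h′ → Point d
      -q y l = - q y l

      p≉-q : ∀ a → ¬ (p (α a) ≋ -q (β a))
      p≉-q a p≋-q = proj₂ (0<fs a) (sym (begin-equality
        f a ∙ s a    ≈⟨ ∙-congˡ (f a) (λ l → trans (+-congʳ (p≋-q l)) (-‿inverseˡ _)) ⟩
        f a ∙ 0ᵥ     ≈⟨ trans (∙-comm (f a) 0ᵥ) (0∙x≈0 (f a)) ⟩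
        0#           ∎))

      open Pairs p -q p≉-q

      dir : Fin k → Point d
      dir = onPair _-ᵥ_ points ∘ pair

      Signed : Point d → Point d → Set
      Signed x y = ∃ λ σ → σ * σ ≈ 1# × x ≋ σ · y

      joins⇒signed : ∀ a {x y} → Joins (p (α a)) (-q (β a)) x y → Signed (x -ᵥ y) (s a)
      joins⇒signed a (inj₁ (x≋ , y≋)) = 1# , *-identityˡ 1# , λ l → trans (+-cong (x≋ l) (-‿cong (y≋ l)))
        (solve 2 (λ p q → p :- :- q := :1 :* (p :+ q)) refl _ _)
      joins⇒signed a (inj₂ (x≋ , y≋)) = - 1# , trans (-x*-x≈x*x 1#) (*-identityˡ 1#) , λ l →
        trans (+-cong (x≋ l) (-‿cong (y≋ l)))
          (solve 2 (λ p q → :- q :- p := :- :1 :* (p :+ q)) refl _ _)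

      signed : ∀ a → Signed (dir a) (s a)
      signed a = joins⇒signed a (proj₂ (joined a))

      ∣σ∣≈1 : ∀ {σ} → σ * σ ≈ 1# → ∣ σ ∣ ≈ 1#
      ∣σ∣≈1 {σ} σσ≈1 = square-injective (∣x∣-nonNeg σ) (<⇒≤ 0<1)
        (trans (∣x∣*∣x∣≈x*x σ) (trans σσ≈1 (sym (*-identityˡ 1#))))

      unit-signed : ∀ a {x} → Signed x (s a) → ‖ x ‖ ≈ 1#
      unit-signed a {x} (σ , σσ≈1 , x≋) = begin-equality
        ‖ x ‖              ≈⟨ ‖‖-cong x≋ ⟩
        ‖ σ · s a ‖        ≈⟨ homogeneous σ (s a) ⟩
        ∣ σ ∣ * ‖ s a ‖    ≈⟨ *-cong (∣σ∣≈1 σσ≈1) (unit-s a) ⟩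
        1# * 1#            ≈⟨ *-identityˡ 1# ⟩
        1#                 ∎

      unit-dir : ∀ a → ‖ dir a ‖ ≈ 1#
      unit-dir a = unit-signed a (signed a)

      signed² : ∀ g {x y} → Signed x y → (g ∙ x) * (g ∙ x) ≈ (g ∙ y) * (g ∙ y)
      signed² g {x} {y} (σ , σσ≈1 , x≋) = begin-equality
        (g ∙ x) * (g ∙ x)                ≈⟨ *-cong g∙x g∙x ⟩
        (σ * (g ∙ y)) * (σ * (g ∙ y))
          ≈⟨ solve 2 (λ σ F → (σ :* F) :* (σ :* F) := (σ :* σ) :* (F :* F)) refl σ (g ∙ y) ⟩
        σ * σ * ((g ∙ y) * (g ∙ y))      ≈⟨ trans (*-congʳ σσ≈1) (*-identityˡ _) ⟩
        (g ∙ y) * (g ∙ y)                ∎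
        where
        g∙x : g ∙ x ≈ σ * (g ∙ y)
        g∙x = trans (∙-congˡ g x≋) (∙-homo-· g σ y)

      -- Parallel unit vectors agree up to sign, so the square of `f a` would take the same value at
      -- the two sums, against the strict inequality.
      nonparallel : ∀ {a b} → a ≢ b → ¬ Parallel (dir a) (dir b)
      nonparallel {a} {b} a≢b (c , dir≋) = proj₂ (fsb<fsa a b (a≢b ∘ ≡.sym)) (sym (begin-equality
        (f a ∙ s a) * (f a ∙ s a)                  ≈⟨ signed² (f a) (signed a) ⟨
        (f a ∙ dir a) * (f a ∙ dir a)              ≈⟨ *-cong f-dir f-dir ⟩
        (c * (f a ∙ dir b)) * (c * (f a ∙ dir b))
          ≈⟨ solve 2 (λ c F → (c :* F) :* (c :* F) := (c :* c) :* (F :* F)) refl c _ ⟩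
        c * c * ((f a ∙ dir b) * (f a ∙ dir b))    ≈⟨ *-cong cc≈1 (signed² (f a) (signed b)) ⟩
        1# * ((f a ∙ s b) * (f a ∙ s b))           ≈⟨ *-identityˡ _ ⟩
        (f a ∙ s b) * (f a ∙ s b)                  ∎))
        where
        f-dir : f a ∙ dir a ≈ c * (f a ∙ dir b)
        f-dir = trans (∙-congˡ (f a) dir≋) (∙-homo-· (f a) c (dir b))
        ∣c∣≈1 : ∣ c ∣ ≈ 1#
        ∣c∣≈1 = begin-equality
          ∣ c ∣                ≈⟨ *-identityʳ _ ⟨
          ∣ c ∣ * 1#           ≈⟨ *-congˡ (unit-dir b) ⟨
          ∣ c ∣ * ‖ dir b ‖    ≈⟨ homogeneous c (dir b) ⟨
          ‖ c · dir b ‖        ≈⟨ ‖‖-cong dir≋ ⟨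
          ‖ dir a ‖            ≈⟨ unit-dir a ⟩
          1#                   ∎
        cc≈1 : c * c ≈ 1#
        cc≈1 = trans (sym (∣x∣*∣x∣≈x*x c)) (trans (*-cong ∣c∣≈1 ∣c∣≈1) (*-identityˡ 1#))

      pair-inj : ∀ {a b} → pair a ≡ pair b → a ≡ b
      pair-inj {a} {b} eq with a Fin.≟ b
      ... | yes a≡b = a≡b
      ... | no  a≢b = ⊥-elim (nonparallel a≢b (1# , λ l → trans
        (reflexive (≡.cong (λ e → onPair _-ᵥ_ points e l) eq)) (sym (*-identityˡ _))))

  direction : ∀ {d} → Fin (d ℕ.* 2) → Point d
  direction {d} c with Fin.remQuot {d} 2 c
  ... | j , zero     = unit j
  ... | j , suc zero = (- 1#) · unit j

  abstract

    transversal : ∀ {d} {f : Point d} → ¬ (f ≋ 0ᵥ) → ∃ λ c → 0# < f ∙ direction c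
    transversal {d} {f} f≉0 with Fin.¬∀⟶∃¬ d (λ j → f j ≈ 0#) (λ _ → lem) f≉0
    ... | j , fj≉0 with total 0# (f j)
    ...   | inj₁ 0≤fj = Fin.combine j zero , positive
      where
      positive : 0# < f ∙ direction (Fin.combine j (zero {1}))
      positive rewrite Fin.remQuot-combine {d} {2} j zero =
        <-respʳ (sym (trans (∙-comm f (unit j)) (unit-∙ j f))) (0≤fj , fj≉0 ∘ sym)
    ...   | inj₂ fj≤0 = Fin.combine j (suc zero) , positive
      where
      positive : 0# < f ∙ direction (Fin.combine j (suc (zero {0})))
      positive rewrite Fin.remQuot-combine {d} {2} j (suc zero) = <-respʳ
        (sym (trans (∙-homo-· f (- 1#) (unit j)) (trans (*-congˡ (trans (∙-comm f (unit j)) (unit-∙ j f)))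
          (solve 1 (λ x → :- :1 :* x := :- x) refl (f j)))))
        (x<0⇒0<-x (fj≤0 , fj≉0))

  abstract

    -- The zero functional separates strictly only if there is no other point. Then any functional
    -- will do, and the all-ones vector is nonzero in positive dimension.
    separateNonzero : ∀ {d k} {s : Fin k → Point d} → Fin d → ConvexlyIndependentFamily s → ∀ a →
      ∃ λ f → ¬ (f ≋ 0ᵥ) × (∀ b → b ≢ a → f ∙ s b < f ∙ s a)
    separateNonzero {s = s} j₀ indep a with f , sep ← separate indep a with lem {f ≋ 0ᵥ}
    ... | no  f≉0 = f , f≉0 , sep
    ... | yes f≋0 = (λ _ → 1#) , (λ 1≋0 → 0≉1 (sym (1≋0 j₀))) , λ b b≢a →
      ⊥-elim (proj₂ (sep b b≢a) (trans (f∙≈0 (s b)) (sym (f∙≈0 (s a)))))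
      where
      f∙≈0 : ∀ x → f ∙ x ≈ 0#
      f∙≈0 x = trans (trans (∙-comm f x) (trans (∙-congˡ x f≋0) (∙-comm x 0ᵥ))) (0∙x≈0 x)

  select : ∀ {d h h′ k k′} → (Fin k′ → Fin k) → Sums d h h′ k → Sums d h h′ k′
  select ι F = record { p = p ; q = q ; α = α ∘ ι ; β = β ∘ ι }
    where open Sums F

  -- If f a ∙ u is positive, then f a is larger in absolute value at the a-th sum
  -- than at the others once all sums are translated far enough along u.
  module FarTranslate {d h h′ k} (F : Sums d h h′ k) (f : Fin k → Point d) (u : Point d)
    (0<fu : ∀ a → 0# < f a ∙ u)
    (fsb<fsa : ∀ a b → b ≢ a → f a ∙ Sums.s F b < f a ∙ Sums.s F a) where

    open Sums F

    -- The summand `1#` is a margin: after the translation the two values of `f a` add up to at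
    -- least 1, so their sum is strictly positive.
    reach : ∀ a → ∃ λ t → 0# ≤ t × (∀ b → 1# - (f a ∙ s a + f a ∙ s b) ≤ t * (f a ∙ u + f a ∙ u))
    reach a = dominate _ _ λ b → +-pos-nonNeg (0<fu a) (<⇒≤ (0<fu a))

    farthest : ∃ λ t → 0# ≤ t × (∀ a → proj₁ (reach a) ≤ t)
    farthest = upperBound (proj₁ ∘ reach)

    t : ℝ
    t = proj₁ farthest

    v : Point d
    v = t · u

    translated : Sums d h h′ k
    translated = record { p = λ x → p x +ᵥ v ; q = q ; α = α ; β = β }

    s′ : Fin k → Point d
    s′ = Sums.s translated

    f∙s′ : ∀ a b → f a ∙ s′ b ≈ f a ∙ s b + t * (f a ∙ u)
    f∙s′ a b = begin-equality
      f a ∙ s′ b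
        ≈⟨ ∙-congˡ (f a) (λ l → solve 3 (λ p q v → (p :+ v) :+ q := (p :+ q) :+ v) refl
                                         (p (α b) l) (q (β b) l) (v l)) ⟩
      f a ∙ (s b +ᵥ v)            ≈⟨ ∙-distribˡ-+ᵥ (f a) (s b) v ⟩
      f a ∙ s b + f a ∙ v         ≈⟨ +-congˡ (∙-homo-· (f a) t u) ⟩
      f a ∙ s b + t * (f a ∙ u)   ∎

    sum-pos : ∀ a b → 0# < f a ∙ s′ a + f a ∙ s′ b
    sum-pos a b = <-≤-trans 0<1 (0≤y-x⇒x≤y (≤-respʳ eq (x≤y⇒0≤y-x (begin
      1# - (f a ∙ s a + f a ∙ s b)          ≤⟨ proj₂ (proj₂ (reach a)) b ⟩
      proj₁ (reach a) * (f a ∙ u + f a ∙ u) ≈⟨ *-comm _ _ ⟩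
      (f a ∙ u + f a ∙ u) * proj₁ (reach a)
        ≤⟨ *-monoˡ-≤-nonNeg (+-nonNeg (<⇒≤ (0<fu a)) (<⇒≤ (0<fu a)))
             (proj₂ (proj₂ farthest) a) ⟩
      (f a ∙ u + f a ∙ u) * t               ∎))))
      where
      eq : (f a ∙ u + f a ∙ u) * t - (1# - (f a ∙ s a + f a ∙ s b)) ≈ f a ∙ s′ a + f a ∙ s′ b - 1#
      eq = trans
        (solve 4 (λ U t A B → (U :+ U) :* t :- (:1 :- (A :+ B)) := (A :+ t :* U) :+ (B :+ t :* U) :- :1)
          refl (f a ∙ u) t (f a ∙ s a) (f a ∙ s b))
        (+-congʳ (sym (+-cong (f∙s′ a a) (f∙s′ a b))))

    0<fs′ : ∀ a → 0# < f a ∙ s′ a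
    0<fs′ a = ≰⇒> λ fs′≤0 → <⇒≱ (sum-pos a a) (≤-respʳ (+-identityˡ 0#) (+-mono-≤ fs′≤0 fs′≤0))

    -- The difference of squares is the product of A - B, which the translation leaves unchanged,
    -- and A + B, which it makes positive.
    fs′²< : ∀ a b → b ≢ a → (f a ∙ s′ b) * (f a ∙ s′ b) < (f a ∙ s′ a) * (f a ∙ s′ a)
    fs′²< a b b≢a = 0<y-x⇒x<y (<-respʳ
      (solve 2 (λ A B → (A :- B) :* (A :+ B) := A :* A :- B :* B) refl (f a ∙ s′ a) (f a ∙ s′ b))
      (*-pos (<-respʳ eq (x<y⇒0<y-x (fsb<fsa a b b≢a))) (sum-pos a b)))
      where
      eq : f a ∙ s a - f a ∙ s b ≈ f a ∙ s′ a - f a ∙ s′ b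
      eq = trans (solve 3 (λ A B T → A :- B := (A :+ T) :- (B :+ T)) refl _ _ (t * (f a ∙ u)))
                 (+-cong (sym (f∙s′ a a)) (-‿cong (sym (f∙s′ a b))))

  sums⇒segments : ∀ {d h h′ k} → Fin d →
    (F : Sums d h h′ (ℕ.suc k)) (f : Fin (ℕ.suc k) → Point d) (u : Point d) →
    (∀ a → 0# < f a ∙ u) → (∀ a b → b ≢ a → f a ∙ Sums.s F b < f a ∙ Sums.s F a) →
    NonparallelUnitSegments d (h ℕ.+ h′) (ℕ.suc k)
  sums⇒segments j₀ F f u 0<fu fsb<fsa =
    Construction.segments j₀ translated (unitNorm s′ f 0<fs′ fs′²<) f 0<fs′ fs′²<
    where open FarTranslate F f u 0<fu fsb<fsa

  E-lower : ∀ {d n k} (P : PointSet d n) → ConvexMidpoints P k → k ℕ.≤ E d n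
  E-lower {d} {n} {k} P mids = ℕ.≤-trans
    (max-upper (midpoints-bounded P) {k} mids)
    (max-upper (E-bounded d n) (P , ≡.refl))

  independentSums≤W : ∀ {d h h′ k} (F : Sums (ℕ.suc d) h h′ k) → ConvexlyIndependentFamily (Sums.s F) →
                      k ℕ.≤ ℕ.suc d ℕ.* 2 ℕ.* W (ℕ.suc d) (h ℕ.+ h′)
  independentSums≤W {d} {h} {h′} {k} F independent =
    let c , k′ , selection , k≤ = pigeonhole colour
    in ℕ.≤-trans k≤ (ℕ.*-monoʳ-≤ (ℕ.suc d ℕ.* 2) (k′≤W selection))
    where
    separator : ∀ a → ∃ λ f → ¬ (f ≋ 0ᵥ) × (∀ b → b ≢ a → f ∙ Sums.s F b < f ∙ Sums.s F a)
    separator = separateNonzero zero independent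

    f : Fin k → Point (ℕ.suc d)
    f = proj₁ ∘ separator

    colour : Fin k → Fin (ℕ.suc d ℕ.* 2)
    colour a = proj₁ (transversal (proj₁ (proj₂ (separator a))))

    0<f∙direction : ∀ a → 0# < f a ∙ direction (colour a)
    0<f∙direction a = proj₂ (transversal (proj₁ (proj₂ (separator a))))

    k′≤W : ∀ {c k′} → Selection (λ a → colour a ≡ c) k′ → k′ ℕ.≤ W (ℕ.suc d) (h ℕ.+ h′)
    -- The norm is a maximum over the selected sums and needs at least one of them, so the empty
    -- selection is treated apart.
    k′≤W {c} {ℕ.zero}   _ = ℕ.z≤n
    k′≤W {c} {ℕ.suc k′} (ι , ι-inj , colour≡c) = max-upper (W-bounded (ℕ.suc d) (h ℕ.+ h′)) {ℕ.suc k′}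
      (sums⇒segments zero (select ι F) (f ∘ ι) (direction c)
        (λ a → ≡.subst (λ c → 0# < f (ι a) ∙ direction c) (colour≡c a) (0<f∙direction (ι a)))
        (λ a b b≢a → proj₂ (proj₂ (separator (ι a))) (ι b) (b≢a ∘ ι-inj)))

  -- Two blocks of ⌊n/2⌋ indices leave at most one over, which a third block holds because `2 ≤ n`
  -- makes it nonempty. Equality occurs at n = 3.
  n≤3⌊n/2⌋×n≤3⌈n/2⌉ : ∀ n → 2 ℕ.≤ n → n ℕ.≤ 3 ℕ.* ℕ.⌊ n /2⌋ × n ℕ.≤ 3 ℕ.* ℕ.⌈ n /2⌉
  n≤3⌊n/2⌋×n≤3⌈n/2⌉ n 2≤n = n≤3⌊n/2⌋ , ℕ.≤-trans n≤3⌊n/2⌋ (ℕ.*-monoʳ-≤ 3 (ℕ.⌊n/2⌋≤⌈n/2⌉ n))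
    where
    ⌈n/2⌉≤ : ∀ n → ℕ.⌈ n /2⌉ ℕ.≤ ℕ.suc ℕ.⌊ n /2⌋
    ⌈n/2⌉≤ ℕ.zero            = ℕ.z≤n
    ⌈n/2⌉≤ (ℕ.suc ℕ.zero)    = ℕ.s≤s ℕ.z≤n
    ⌈n/2⌉≤ (ℕ.suc (ℕ.suc n)) = ℕ.s≤s (⌈n/2⌉≤ n)

    n≤3⌊n/2⌋ : n ℕ.≤ 3 ℕ.* ℕ.⌊ n /2⌋
    n≤3⌊n/2⌋ = ℕ.≤-trans (ℕ.≤-reflexive (≡.sym (ℕ.⌊n/2⌋+⌈n/2⌉≡n n))) (ℕ.+-monoʳ-≤ ℕ.⌊ n /2⌋
      (ℕ.≤-trans (⌈n/2⌉≤ n) (ℕ.≤-trans (ℕ.+-monoˡ-≤ ℕ.⌊ n /2⌋ (ℕ.⌊n/2⌋-mono 2≤n))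
        (ℕ.+-monoʳ-≤ ℕ.⌊ n /2⌋ (ℕ.m≤m+n ℕ.⌊ n /2⌋ 0)))))

  -- The factor 9 is lost in choosing blocks; `c` is lost in turning sums into a configuration and
  -- is 1 for midpoints and twice the dimension for segments. The two block sizes add up to exactly
  -- `n`.
  M≤ : ∀ {d n c} {f : ℕ → ℕ} → 2 ℕ.≤ n →
       (∀ {h h′ k} (F : Sums d h h′ k) → ConvexlyIndependentFamily (Sums.s F) → k ℕ.≤ c ℕ.* f (h ℕ.+ h′)) →
       M d n n ℕ.≤ 9 ℕ.* c ℕ.* f n
  M≤ {d} {n} {c} {f} 2≤n bound =
    max≤ {ConvexSubsetOfSum d n n} (n ℕ.* n , convexSubsetOfSum-bound) λ {k} sumset →
      let n≤3h , n≤3h′ = n≤3⌊n/2⌋×n≤3⌈n/2⌉ n 2≤n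
          k′ , F , independent , k≤9k′ = restrictToBlocks {h = ℕ.⌊ n /2⌋} {ℕ.⌈ n /2⌉} {k}
            (Fin.fromℕ< (ℕ.<-≤-trans (ℕ.s≤s ℕ.z≤n) 2≤n)) n≤3h n≤3h′ sumset
      in ℕ.≤-trans k≤9k′ (ℕ.≤-trans (ℕ.*-monoʳ-≤ 9 (bound F independent)) (ℕ.≤-reflexive
           (≡.trans (≡.cong (λ m → 9 ℕ.* (c ℕ.* f m)) (ℕ.⌊n/2⌋+⌈n/2⌉≡n n)) (≡.sym (ℕ.*-assoc 9 c (f n))))))

  M≤9E : ∀ d n → 2 ℕ.≤ n → M (ℕ.suc d) n n ℕ.≤ 9 ℕ.* E (ℕ.suc d) n
  M≤9E d n 2≤n = M≤ {c = 1} {E (ℕ.suc d)} 2≤n λ {h} {h′} {k} F independent →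
    let P , mids = Construction.midpoints zero F independent
    in ℕ.≤-trans (E-lower {k = k} P mids) (ℕ.m≤m+n _ 0)

  M≤cW : ∀ d n → 2 ℕ.≤ n → M (ℕ.suc d) n n ℕ.≤ 9 ℕ.* (ℕ.suc d ℕ.* 2) ℕ.* W (ℕ.suc d) n
  M≤cW d n 2≤n = M≤ {c = ℕ.suc d ℕ.* 2} {W (ℕ.suc d)} 2≤n independentSums≤W

-- From inequalities between naturals to asymptotic equivalence.

module Asymptotics (lem : ExcludedMiddle 0ℓ) (R : CompleteOrderedField) where

  open CompleteOrderedField R hiding (zero)
  open Extremal lem R
  open OrderedField lem R
  open ≤-Reasoning
  open import Algebra.Properties.Semiring.Mult semiring using (×1-homo-*)

  fromℕ-nonNeg : ∀ n → 0# ≤ fromℕ n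
  fromℕ-nonNeg ℕ.zero    = ≤-refl
  fromℕ-nonNeg (ℕ.suc n) = +-nonNeg (<⇒≤ 0<1) (fromℕ-nonNeg n)

  fromℕ-pos : ∀ n → 0# < fromℕ (ℕ.suc n)
  fromℕ-pos n = +-pos-nonNeg 0<1 (fromℕ-nonNeg n)

  fromℕ-mono-≤ : ∀ {m n} → m ℕ.≤ n → fromℕ m ≤ fromℕ n
  fromℕ-mono-≤ {n = n} ℕ.z≤n = fromℕ-nonNeg n
  fromℕ-mono-≤ (ℕ.s≤s m≤n)   = +-monoʳ-≤ 1# (fromℕ-mono-≤ m≤n)

  -- Factors written as successors are positive in ℝ, so the first can be inverted to give the lower
  -- constant.
  asymptoticallyEquivalent : ∀ {f g : ℕ → ℕ} a b →
    (∀ n → 2 ℕ.≤ n → f n ℕ.≤ ℕ.suc a ℕ.* g n) → (∀ n → 2 ℕ.≤ n → g n ℕ.≤ ℕ.suc b ℕ.* f n) →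
    AsymptoticallyEquivalent f g
  asymptoticallyEquivalent {f} {g} a b f≤ g≤ =
    A ⁻¹ , fromℕ (ℕ.suc b) , ⁻¹-pos (fromℕ-pos a) , fromℕ-pos b , λ n 2≤n →
    (begin
      A ⁻¹ * fromℕ (f n)
        ≤⟨ *-monoˡ-≤-nonNeg (<⇒≤ (⁻¹-pos (fromℕ-pos a))) (fromℕ-mono-≤ (f≤ n 2≤n)) ⟩
      A ⁻¹ * fromℕ (ℕ.suc a ℕ.* g n)    ≈⟨ *-congˡ (×1-homo-* (ℕ.suc a) (g n)) ⟩
      A ⁻¹ * (A * fromℕ (g n))          ≈⟨ *-assoc _ _ _ ⟨
      A ⁻¹ * A * fromℕ (g n)            ≈⟨ *-congʳ (⁻¹-inverseˡ (proj₂ (fromℕ-pos a) ∘ sym)) ⟩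
      1# * fromℕ (g n)                  ≈⟨ *-identityˡ _ ⟩
      fromℕ (g n)                       ∎) ,
    (begin
      fromℕ (g n)                       ≤⟨ fromℕ-mono-≤ (g≤ n 2≤n) ⟩
      fromℕ (ℕ.suc b ℕ.* f n)           ≈⟨ ×1-homo-* (ℕ.suc b) (f n) ⟩
      fromℕ (ℕ.suc b) * fromℕ (f n)     ∎)
    where
    A : ℝ
    A = fromℕ (ℕ.suc a)

open import Data.Nat using (_≤_)

proposition4 : (lem : ExcludedMiddle 0ℓ) (R : CompleteOrderedField) →
    let open Extremal lem R in
    (d : ℕ) → 1 ≤ d →
    AsymptoticallyEquivalent (λ n → M d n n) (E d) ×
    AsymptoticallyEquivalent (λ n → M d n n) (W d) ×
    AsymptoticallyEquivalent (E d) (W d)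
proposition4 lem R (ℕ.suc d) _ =
  -- The arguments are the predecessors of the factors: 8 stands for 9 and 0 for 1. `E` and `W` are
  -- compared with each other through `M`.
  asymptoticallyEquivalent 8 0 (M≤9E d) (λ n _ → E≤1*M n) ,
  asymptoticallyEquivalent c 0 (M≤cW d) (λ n _ → W≤1*M n) ,
  asymptoticallyEquivalent c 8
    (λ n 2≤n → ℕ.≤-trans (E≤M (ℕ.suc d) n) (M≤cW d n 2≤n))
    (λ n 2≤n → ℕ.≤-trans (W≤M (ℕ.suc d) n) (M≤9E d n 2≤n))
  where
  open Extremal lem R
  open UpperBounds lem R using (E≤M; W≤M)
  open LowerBounds lem R using (M≤9E; M≤cW)
  open Asymptotics lem R using (asymptoticallyEquivalent)

  c : ℕ
  -- The product of successors computes to a successor, so `ℕ.suc c` is the factor of `M≤cW` by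
  -- definition.
  c = ℕ.pred (9 ℕ.* (ℕ.suc d ℕ.* 2))

  E≤1*M : ∀ n → E (ℕ.suc d) n ≤ 1 ℕ.* M (ℕ.suc d) n n
  E≤1*M n = ℕ.≤-trans (E≤M (ℕ.suc d) n) (ℕ.m≤m+n _ 0)

  W≤1*M : ∀ n → W (ℕ.suc d) n ≤ 1 ℕ.* M (ℕ.suc d) n n
  W≤1*M n = ℕ.≤-trans (W≤M (ℕ.suc d) n) (ℕ.m≤m+n _ 0)
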